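{- Let $\gamma_n := \frac{4}{(n+7)(n-1)} = \frac{4-o(1)}{n^2}$ and $\gamma'_n := \frac{2}{(n+2)(n-1)}$. For every odd $n\ge 5$ and any unate unbiased $f:\{ -1,1\}^n\to\{ -1,1\}$: (i) $\mathrm{Stab}_\rho[\mathrm{Maj}_n]\le \mathrm{Stab}_\rho[f]$ for all $\rho\in(1-2\gamma_n,1)$; (ii) $\Phi_p[\mathrm{Maj}_n]\ge\Phi_p[f]$ for all $p\in(0,\gamma_n)$. Moreover, for every odd $n\ge5$ and any (possibly non-unate) unbiased $f:\{ -1,1\}^n\to\{ -1,1\}$: (iii) $\Phi_p[\mathrm{Maj}_n]\ge\Phi_p[f]$ for all $p\in(0,\gamma'_n)$. In all three cases, the inequality is strict as long as $f$ is not $\mathrm{Maj}_n$ up to sign flips, i.e., as long as there is no $a\in\{ -1,1\}^n$ such that $f(x)=\mathrm{Maj}_n(a_1x_1,\dots,a_nx_n)$ for all $x\in\{ -1,1\}^n$.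
   Context: A function $f:\{ -1,1\}^n\to\{ -1,1\}$ is unbiased if $\mathbb{E}[f(x)]=0$ for $x$ uniform on $\{ -1,1\}^n$. It is unate if for each coordinate $i$ it is monotone in $x_i$, either (weakly) increasing in $x_i$ or (weakly) decreasing in $x_i$ (the direction may depend on $i$ but not on the other coordinates). For odd $n$, $\mathrm{Maj}_n(x)=\mathrm{sign}(\sum_{i=1}^n x_i)$. For $\rho\in[0,1]$, $\mathrm{DSBS}_\rho$ is the distribution of $(x,y)\in\{ -1,1\}^2$ with $\Pr[x=y=1]=\Pr[x=y=-1]=\frac{1+\rho}{4}$ and $\Pr[x=1,y=-1]=\Pr[x=-1,y=1]=\frac{1-\rho}{4}$. The noise stability is $\mathrm{Stab}_\rho[f]:=\mathbb{E}[f(x)f(y)]$ for $(x,y)\sim \mathrm{DSBS}_\rho^{\otimes n}$, i.e. the coordinate pairs $(x_i,y_i)$ are i.i.d. from $\mathrm{DSBS}_\rho$. For $p\in[0,1]$, $\mathrm{SBES}_p$ is the distribution of $(x,y)\in\{ -1,1\}\times\{ -1,1,\star\}$ where $x$ is uniform and $y=x$ with probability $p$ and $y=\star$ (erased) with probability $1-p$, independently of $x$. Define $\Phi_p[f]:=\mathbb{E}_y\big[\,|\mathbb{E}[f(x)\mid y]|\,\big]$ for $(x,y)\sim\mathrm{SBES}_p^{\otimes n}$ (i.i.d. coordinate pairs). -}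

module Defs where

open import Data.Nat as ℕ using (ℕ; zero; suc)
import Data.Nat.Properties as ℕ
open import Data.Integer as ℤ using (ℤ; 0ℤ; +_; _◃_)
import Data.Integer.Properties as ℤ
import Data.Rational.Unnormalised as ℚᵘ
import Data.Rational.Unnormalised.Properties as ℚᵘ
open import Data.Rational as ℚ using (ℚ; 0ℚ; 1ℚ; ½; ∣_∣)
import Data.Rational.Properties as ℚ
open import Data.Rational.Solver using (module +-*-Solver)
open import Data.Fin using (Fin)
open import Data.Sign as Sign using (Sign)
open import Data.Maybe using (Maybe; just; nothing; fromMaybe)
open import Data.List as List using (List; []; _∷_; cartesianProductWith)
open import Data.List.Membership.Propositional using (_∈_)
open import Data.List.Membership.Propositional.Properties using (∈-cartesianProductWith⁺)
open import Data.List.Relation.Unary.Any using (here; there)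
open import Data.Vec as Vec using (Vec; []; _∷_; zipWith; _[_]≔_)
open import Data.Product using (∃; _×_; _,_; proj₁; proj₂)
open import Data.Sum using (_⊎_; inj₁; inj₂)
open import Relation.Binary.PropositionalEquality using (_≡_; refl; sym; trans; cong; subst; subst₂)

open +-*-Solver using (solve; _:+_; _:*_; _:-_; _:=_; :-_)

------------------------------------------------------------------------
-- Real numbers: Cauchy sequences of rationals, compared by _≈_.

Eventually : (ℕ → Set) → Set
Eventually P = ∃ λ N → ∀ n → N ℕ.≤ n → P n

IsCauchy : (ℕ → ℚ) → Set
IsCauchy u = ∀ ε → 0ℚ ℚ.< ε →
  ∃ λ N → ∀ m n → N ℕ.≤ m → N ℕ.≤ n → ∣ u m ℚ.- u n ∣ ℚ.≤ ε

record ℝ : Set where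
  constructor mkℝ
  field
    seq    : ℕ → ℚ
    cauchy : IsCauchy seq

open ℝ public

infix 4 _≈_ _≤_ _<_

_≈_ _≤_ _<_ : ℝ → ℝ → Set
x ≈ y = ∀ ε → 0ℚ ℚ.< ε → Eventually λ n → ∣ seq x n ℚ.- seq y n ∣ ℚ.≤ ε
x ≤ y = ∀ ε → 0ℚ ℚ.< ε → Eventually λ n → seq x n ℚ.≤ seq y n ℚ.+ ε
x < y = ∃ λ ε → 0ℚ ℚ.< ε × Eventually λ n → seq x n ℚ.+ ε ℚ.≤ seq y n

a≡a-b+b : ∀ a b → a ≡ (a ℚ.- b) ℚ.+ b
a≡a-b+b = solve 2 (λ a b → a := (a :- b) :+ b) refl

a≡b-[b-a] : ∀ a b → a ≡ b ℚ.+ ℚ.- (b ℚ.- a)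
a≡b-[b-a] = solve 2 (λ a b → a := b :+ :- (b :- a)) refl

a+b-b≡a : ∀ a b → a ℚ.+ b ℚ.- b ≡ a
a+b-b≡a = solve 2 (λ a b → a :+ b :- b := a) refl

a+b-a≡b : ∀ a b → a ℚ.+ b ℚ.- a ≡ b
a+b-a≡b = solve 2 (λ a b → a :+ b :- a := b) refl

-[a-b]≡b-a : ∀ a b → ℚ.- (a ℚ.- b) ≡ b ℚ.- a
-[a-b]≡b-a = solve 2 (λ a b → :- (a :- b) := b :- a) refl

-a--b≡-[a-b] : ∀ a b → (ℚ.- a) ℚ.- (ℚ.- b) ≡ ℚ.- (a ℚ.- b)
-a--b≡-[a-b] = solve 2 (λ a b → (:- a) :- (:- b) := :- (a :- b)) refl

+-regroup : ∀ a b c d → (a ℚ.+ b) ℚ.- (c ℚ.+ d) ≡ (a ℚ.- c) ℚ.+ (b ℚ.- d)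
+-regroup = solve 4 (λ a b c d → (a :+ b) :- (c :+ d) := (a :- c) :+ (b :- d)) refl

*-regroup : ∀ a b c d → a ℚ.* c ℚ.- b ℚ.* d ≡ a ℚ.* (c ℚ.- d) ℚ.+ d ℚ.* (a ℚ.- b)
*-regroup = solve 4 (λ a b c d → a :* c :- b :* d := a :* (c :- d) :+ d :* (a :- b)) refl

collect : ∀ a b e i → a ℚ.* (e ℚ.* i) ℚ.+ b ℚ.* (e ℚ.* i) ≡ e ℚ.* ((a ℚ.+ b) ℚ.* i)
collect = solve 4 (λ a b e i → a :* (e :* i) :+ b :* (e :* i) := e :* ((a :+ b) :* i)) refl

pair-up : ∀ v e ε → (v ℚ.* v) ℚ.* (e ℚ.* e ℚ.* ε) ≡ (e ℚ.* v) ℚ.* ((e ℚ.* v) ℚ.* ε)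
pair-up = solve 3 (λ v e ε → (v :* v) :* (e :* e :* ε) := (e :* v) :* ((e :* v) :* ε)) refl

cross : ∀ p q a b → (p ℚ.* q) ℚ.* (b ℚ.- a) ≡ p ℚ.* (b ℚ.* q) ℚ.- q ℚ.* (a ℚ.* p)
cross = solve 4 (λ p q a b → (p :* q) :* (b :- a) := p :* (b :* q) :- q :* (a :* p)) refl

ev-map : ∀ {P Q : ℕ → Set} → (∀ n → P n → Q n) → Eventually P → Eventually Q
ev-map f (N , p) = N , λ n N≤n → f n (p n N≤n)

ev-∩ : ∀ {P Q : ℕ → Set} → Eventually P → Eventually Q → Eventually (λ n → P n × Q n)
ev-∩ (M , p) (N , q) = M ℕ.⊔ N , λ n k →
  p n (ℕ.≤-trans (ℕ.m≤m⊔n M N) k) , q n (ℕ.≤-trans (ℕ.m≤n⊔m M N) k)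

*-pos : ∀ {a b} → 0ℚ ℚ.< a → 0ℚ ℚ.< b → 0ℚ ℚ.< a ℚ.* b
*-pos {a} {b} 0<a 0<b = ℚ.positive⁻¹ (a ℚ.* b)
  {{ℚ.pos*pos⇒pos a {{ℚ.positive 0<a}} b {{ℚ.positive 0<b}}}}

*-nonneg : ∀ {a b} → 0ℚ ℚ.≤ a → 0ℚ ℚ.≤ b → 0ℚ ℚ.≤ a ℚ.* b
*-nonneg {a} {b} 0≤a 0≤b = ℚ.nonNegative⁻¹ (a ℚ.* b)
  {{ℚ.nonNeg*nonNeg⇒nonNeg a {{ℚ.nonNegative 0≤a}} b {{ℚ.nonNegative 0≤b}}}}

*-mono-≤ : ∀ {a b c d} → 0ℚ ℚ.≤ b → 0ℚ ℚ.≤ c → a ℚ.≤ b → c ℚ.≤ d → a ℚ.* c ℚ.≤ b ℚ.* d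
*-mono-≤ {a} {b} {c} {d} 0≤b 0≤c a≤b c≤d = ℚ.≤-trans
  (ℚ.*-monoʳ-≤-nonNeg c {{ℚ.nonNegative 0≤c}} a≤b)
  (ℚ.*-monoˡ-≤-nonNeg b {{ℚ.nonNegative 0≤b}} c≤d)

0≤∣_∣ : ∀ p → 0ℚ ℚ.≤ ∣ p ∣
0≤∣ p ∣ = ℚ.nonNegative⁻¹ ∣ p ∣ {{ℚ.∣-∣-nonNeg p}}

bounded : ∀ x → ∃ λ B → 0ℚ ℚ.< B × Eventually λ n → ∣ seq x n ∣ ℚ.≤ B
bounded x with cauchy x 1ℚ (ℚ.positive⁻¹ 1ℚ)
... | N , h = 1ℚ ℚ.+ ∣ c ∣ , 0<B , N , λ n N≤n →
  ℚ.≤-trans (ℚ.≤-reflexive (cong ∣_∣ (a≡a-b+b (seq x n) c)))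
    (ℚ.≤-trans (ℚ.∣p+q∣≤∣p∣+∣q∣ (seq x n ℚ.- c) c)
      (ℚ.+-monoˡ-≤ ∣ c ∣ (h n N N≤n ℕ.≤-refl)))
  where
  c = seq x N
  0<B : 0ℚ ℚ.< 1ℚ ℚ.+ ∣ c ∣
  0<B = ℚ.+-mono-<-≤ (ℚ.positive⁻¹ 1ℚ) 0≤∣ c ∣

half+half : ∀ ε → ½ ℚ.* ε ℚ.+ ½ ℚ.* ε ≡ ε
half+half ε = trans (sym (ℚ.*-distribʳ-+ ε ½ ½)) (ℚ.*-identityˡ ε)

∣*∣-mono-≤ : ∀ p q {P Q} → 0ℚ ℚ.≤ P → ∣ p ∣ ℚ.≤ P → ∣ q ∣ ℚ.≤ Q → ∣ p ℚ.* q ∣ ℚ.≤ P ℚ.* Q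
∣*∣-mono-≤ p q {P} {Q} 0≤P p≤P q≤Q = subst (ℚ._≤ P ℚ.* Q) (sym (ℚ.∣p*q∣≡∣p∣*∣q∣ p q))
  (*-mono-≤ {∣ p ∣} {P} {∣ q ∣} {Q} 0≤P 0≤∣ q ∣ p≤P q≤Q)

*-close : ∀ a b c d {A B δ} → 0ℚ ℚ.≤ A → 0ℚ ℚ.≤ B → ∣ a ∣ ℚ.≤ A → ∣ d ∣ ℚ.≤ B →
          ∣ a ℚ.- b ∣ ℚ.≤ δ → ∣ c ℚ.- d ∣ ℚ.≤ δ →
          ∣ a ℚ.* c ℚ.- b ℚ.* d ∣ ℚ.≤ A ℚ.* δ ℚ.+ B ℚ.* δ
*-close a b c d {A} {B} {δ} 0≤A 0≤B a≤A d≤B a-b≤δ c-d≤δ =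
  subst (λ t → ∣ t ∣ ℚ.≤ A ℚ.* δ ℚ.+ B ℚ.* δ) (sym (*-regroup a b c d))
    (ℚ.≤-trans (ℚ.∣p+q∣≤∣p∣+∣q∣ (a ℚ.* (c ℚ.- d)) (d ℚ.* (a ℚ.- b)))
      (ℚ.+-mono-≤ (∣*∣-mono-≤ a (c ℚ.- d) 0≤A a≤A c-d≤δ) (∣*∣-mono-≤ d (a ℚ.- b) 0≤B d≤B a-b≤δ)))

reciprocal : ∀ e → 0ℚ ℚ.< e → ∃ λ i → 0ℚ ℚ.< i × e ℚ.* i ≡ 1ℚ
reciprocal e 0<e = ℚ.1/ e , ℚ.positive⁻¹ (ℚ.1/ e) {{ℚ.1/pos⇒pos e}} , ℚ.*-inverseʳ e
  where
  instance
    e-pos : ℚ.Positive e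
    e-pos = ℚ.positive 0<e
    e≢0 : ℚ.NonZero e
    e≢0 = ℚ.pos⇒nonZero e

budget : ∀ A B ε → 0ℚ ℚ.< A → 0ℚ ℚ.< B → 0ℚ ℚ.< ε →
         ∃ λ δ → 0ℚ ℚ.< δ × A ℚ.* δ ℚ.+ B ℚ.* δ ≡ ε
budget A B ε 0<A 0<B 0<ε =
  let i , 0<i , inv = reciprocal (A ℚ.+ B) (ℚ.+-mono-< 0<A 0<B)
  in ε ℚ.* i , *-pos 0<ε 0<i ,
     trans (collect A B ε i) (trans (cong (ε ℚ.*_) inv) (ℚ.*-identityʳ ε))

*-cauchy : ∀ x y → IsCauchy (λ n → seq x n ℚ.* seq y n)
*-cauchy x y ε 0<ε =
  let A , 0<A , K , hA = bounded x
      B , 0<B , L , hB = bounded y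
      δ , 0<δ , total  = budget A B ε 0<A 0<B 0<ε
      M₁ , h₁ = cauchy x δ 0<δ
      M₂ , h₂ = cauchy y δ 0<δ
      KL = K ℕ.⊔ L
      MM = M₁ ℕ.⊔ M₂
  in KL ℕ.⊔ MM , λ m n N≤m N≤n →
     let KL≤m = ℕ.m⊔n≤o⇒m≤o KL MM N≤m
         KL≤n = ℕ.m⊔n≤o⇒m≤o KL MM N≤n
         MM≤m = ℕ.m⊔n≤o⇒n≤o KL MM N≤m
         MM≤n = ℕ.m⊔n≤o⇒n≤o KL MM N≤n
     in subst (∣ seq x m ℚ.* seq y m ℚ.- seq x n ℚ.* seq y n ∣ ℚ.≤_) total
          (*-close (seq x m) (seq x n) (seq y m) (seq y n) (ℚ.<⇒≤ 0<A) (ℚ.<⇒≤ 0<B)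
            (hA m (ℕ.m⊔n≤o⇒m≤o K L KL≤m)) (hB n (ℕ.m⊔n≤o⇒n≤o K L KL≤n))
            (h₁ m n (ℕ.m⊔n≤o⇒m≤o M₁ M₂ MM≤m) (ℕ.m⊔n≤o⇒m≤o M₁ M₂ MM≤n))
            (h₂ m n (ℕ.m⊔n≤o⇒n≤o M₁ M₂ MM≤m) (ℕ.m⊔n≤o⇒n≤o M₁ M₂ MM≤n)))

dominated : ∀ x (u : ℕ → ℚ) →
            (∀ m n → ∣ u m ℚ.- u n ∣ ℚ.≤ ∣ seq x m ℚ.- seq x n ∣) → IsCauchy u
dominated x u h ε 0<ε with cauchy x ε 0<ε
... | N , k = N , λ m n N≤m N≤n → ℚ.≤-trans (h m n) (k m n N≤m N≤n)

∣∣-lipschitz : ∀ a b → ∣ ∣ a ∣ ℚ.- ∣ b ∣ ∣ ℚ.≤ ∣ a ℚ.- b ∣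
∣∣-lipschitz a b with ℚ.∣p∣≡p∨∣p∣≡-p (∣ a ∣ ℚ.- ∣ b ∣)
... | inj₁ eq = subst (ℚ._≤ ∣ a ℚ.- b ∣) (sym eq) (tri a b)
  where
  tri : ∀ a b → ∣ a ∣ ℚ.- ∣ b ∣ ℚ.≤ ∣ a ℚ.- b ∣
  tri a b = begin
    ∣ a ∣ ℚ.- ∣ b ∣                      ≡⟨ cong (λ c → ∣ c ∣ ℚ.- ∣ b ∣) (a≡a-b+b a b) ⟩
    ∣ (a ℚ.- b) ℚ.+ b ∣ ℚ.- ∣ b ∣        ≤⟨ ℚ.+-monoˡ-≤ (ℚ.- ∣ b ∣) (ℚ.∣p+q∣≤∣p∣+∣q∣ (a ℚ.- b) b) ⟩
    ∣ a ℚ.- b ∣ ℚ.+ ∣ b ∣ ℚ.- ∣ b ∣      ≡⟨ a+b-b≡a ∣ a ℚ.- b ∣ ∣ b ∣ ⟩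
    ∣ a ℚ.- b ∣                          ∎
    where open ℚ.≤-Reasoning
... | inj₂ eq = begin
    ∣ ∣ a ∣ ℚ.- ∣ b ∣ ∣                  ≡⟨ eq ⟩
    ℚ.- (∣ a ∣ ℚ.- ∣ b ∣)                ≡⟨ -[a-b]≡b-a ∣ a ∣ ∣ b ∣ ⟩
    ∣ b ∣ ℚ.- ∣ a ∣                      ≡⟨ cong (λ c → ∣ c ∣ ℚ.- ∣ a ∣) (a≡b-[b-a] b a) ⟩
    ∣ a ℚ.+ ℚ.- (a ℚ.- b) ∣ ℚ.- ∣ a ∣    ≤⟨ ℚ.+-monoˡ-≤ (ℚ.- ∣ a ∣) (ℚ.∣p+q∣≤∣p∣+∣q∣ a (ℚ.- (a ℚ.- b))) ⟩
    ∣ a ∣ ℚ.+ ∣ ℚ.- (a ℚ.- b) ∣ ℚ.- ∣ a ∣ ≡⟨ a+b-a≡b ∣ a ∣ ∣ ℚ.- (a ℚ.- b) ∣ ⟩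
    ∣ ℚ.- (a ℚ.- b) ∣                    ≡⟨ ℚ.∣-p∣≡∣p∣ (a ℚ.- b) ⟩
    ∣ a ℚ.- b ∣                          ∎
    where open ℚ.≤-Reasoning

fromℚ : ℚ → ℝ
fromℚ q = mkℝ (λ _ → q) λ ε 0<ε → 0 , λ _ _ _ _ →
  subst (ℚ._≤ ε) (sym (cong ∣_∣ (ℚ.+-inverseʳ q))) (ℚ.<⇒≤ 0<ε)

0ℝ 1ℝ : ℝ
0ℝ = fromℚ 0ℚ
1ℝ = fromℚ 1ℚ

infixl 6 _+_ _-_
infixl 7 _*_

_+_ : ℝ → ℝ → ℝ
x + y = mkℝ (λ n → seq x n ℚ.+ seq y n) λ ε 0<ε →
  let 0<½ε = *-pos (ℚ.positive⁻¹ ½) 0<ε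
      (M , h) = cauchy x (½ ℚ.* ε) 0<½ε
      (N , k) = cauchy y (½ ℚ.* ε) 0<½ε
  in M ℕ.⊔ N , λ m n l r →
    ℚ.≤-trans (ℚ.≤-reflexive (cong ∣_∣ (+-regroup (seq x m) (seq y m) (seq x n) (seq y n))))
   (ℚ.≤-trans (ℚ.∣p+q∣≤∣p∣+∣q∣ (seq x m ℚ.- seq x n) (seq y m ℚ.- seq y n))
   (ℚ.≤-trans (ℚ.+-mono-≤
      (h m n (ℕ.≤-trans (ℕ.m≤m⊔n M N) l) (ℕ.≤-trans (ℕ.m≤m⊔n M N) r))
      (k m n (ℕ.≤-trans (ℕ.m≤n⊔m M N) l) (ℕ.≤-trans (ℕ.m≤n⊔m M N) r)))
   (ℚ.≤-reflexive (half+half ε))))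

-_ : ℝ → ℝ
- x = mkℝ (λ n → ℚ.- seq x n) (dominated x (λ n → ℚ.- seq x n) λ m n → ℚ.≤-reflexive (trans
  (cong ∣_∣ (-a--b≡-[a-b] (seq x m) (seq x n)))
  (ℚ.∣-p∣≡∣p∣ (seq x m ℚ.- seq x n))))

_-_ : ℝ → ℝ → ℝ
x - y = x + (- y)

_*_ : ℝ → ℝ → ℝ
x * y = mkℝ (λ n → seq x n ℚ.* seq y n) (*-cauchy x y)

abs : ℝ → ℝ
abs x = mkℝ (λ n → ∣ seq x n ∣) (dominated x (λ n → ∣ seq x n ∣) λ m n → ∣∣-lipschitz (seq x m) (seq x n))

recip-antitone : ∀ {a e u v} → 0ℚ ℚ.≤ u → 0ℚ ℚ.< e → e ℚ.≤ a →
                 a ℚ.* u ≡ 1ℚ → e ℚ.* v ≡ 1ℚ → u ℚ.≤ v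
recip-antitone {a} {e} {u} {v} 0≤u 0<e e≤a au ev =
  ℚ.*-cancelˡ-≤-pos e {{ℚ.positive 0<e}}
    (subst (e ℚ.* u ℚ.≤_) (trans au (sym ev))
      (ℚ.*-monoʳ-≤-nonNeg u {{ℚ.nonNegative 0≤u}} e≤a))

recip-difference : ∀ {a b p q} → a ℚ.* p ≡ 1ℚ → b ℚ.* q ≡ 1ℚ →
                   (p ℚ.* q) ℚ.* (b ℚ.- a) ≡ p ℚ.- q
recip-difference {a} {b} {p} {q} ap bq =
  trans (cross p q a b)
 (trans (cong (λ t → p ℚ.* t ℚ.- q ℚ.* (a ℚ.* p)) bq)
 (trans (cong (λ t → p ℚ.* 1ℚ ℚ.- q ℚ.* t) ap)
 (trans (cong (ℚ._- q ℚ.* 1ℚ) (ℚ.*-identityʳ p))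
        (cong (λ t → p ℚ.- t) (ℚ.*-identityʳ q)))))

recip-close : ∀ {a b p q e v ε} → 0ℚ ℚ.< p → 0ℚ ℚ.< q → 0ℚ ℚ.< e → 0ℚ ℚ.< v →
              e ℚ.≤ a → e ℚ.≤ b → a ℚ.* p ≡ 1ℚ → b ℚ.* q ≡ 1ℚ → e ℚ.* v ≡ 1ℚ →
              ∣ b ℚ.- a ∣ ℚ.≤ e ℚ.* e ℚ.* ε → ∣ p ℚ.- q ∣ ℚ.≤ ε
recip-close {a} {b} {p} {q} {e} {v} {ε} 0<p 0<q 0<e 0<v e≤a e≤b ap bq ev close =
  subst (λ t → ∣ t ∣ ℚ.≤ ε) (recip-difference {a} {b} {p} {q} ap bq)
    (subst (∣ (p ℚ.* q) ℚ.* (b ℚ.- a) ∣ ℚ.≤_) v²e²ε≡ε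
      (∣*∣-mono-≤ (p ℚ.* q) (b ℚ.- a) (*-nonneg 0≤v 0≤v) ∣pq∣≤v² close))
  where
  0≤p = ℚ.<⇒≤ 0<p
  0≤q = ℚ.<⇒≤ 0<q
  0≤v = ℚ.<⇒≤ 0<v
  ∣pq∣≤v² : ∣ p ℚ.* q ∣ ℚ.≤ v ℚ.* v
  ∣pq∣≤v² = subst (ℚ._≤ v ℚ.* v) (sym (ℚ.0≤p⇒∣p∣≡p (*-nonneg 0≤p 0≤q)))
    (*-mono-≤ {p} {v} {q} {v} 0≤v 0≤q
      (recip-antitone {a} {e} {p} {v} 0≤p 0<e e≤a ap ev)
      (recip-antitone {b} {e} {q} {v} 0≤q 0<e e≤b bq ev))
  v²e²ε≡ε : (v ℚ.* v) ℚ.* (e ℚ.* e ℚ.* ε) ≡ ε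
  v²e²ε≡ε = trans (pair-up v e ε)
           (trans (cong (λ t → t ℚ.* (t ℚ.* ε)) ev)
           (trans (ℚ.*-identityˡ (1ℚ ℚ.* ε)) (ℚ.*-identityˡ ε)))

0<⊔ : ∀ {e} → 0ℚ ℚ.< e → ∀ q → 0ℚ ℚ.< q ℚ.⊔ e
0<⊔ {e} 0<e q = ℚ.<-≤-trans 0<e (ℚ.p≤q⊔p q e)

-- For 0 < x as witnessed by e, eventually e ≤ seq x n, so that seq x n ⊔ e is
-- seq x n; the maximum only makes the remaining terms invertible.
recip : (x : ℝ) → 0ℝ < x → ℝ
recip x (e , 0<e , K , hK) = mkℝ (λ n → proj₁ (inverse n)) λ ε 0<ε →
  let N , h = cauchy x (e ℚ.* e ℚ.* ε) (*-pos (*-pos 0<e 0<e) 0<ε)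
      v , 0<v , ev = reciprocal e 0<e
  in N ℕ.⊔ K , λ m n l r →
     let p , 0<p , ap = inverse m
         q , 0<q , bq = inverse n
     in recip-close {seq x m ℚ.⊔ e} {seq x n ℚ.⊔ e} {p} {q} {e} {v} {ε}
          0<p 0<q 0<e 0<v (ℚ.p≤q⊔p (seq x m) e) (ℚ.p≤q⊔p (seq x n) e) ap bq ev
          (subst₂ (λ s t → ∣ s ℚ.- t ∣ ℚ.≤ e ℚ.* e ℚ.* ε)
            (sym (above n (ℕ.m⊔n≤o⇒n≤o N K r))) (sym (above m (ℕ.m⊔n≤o⇒n≤o N K l)))
            (h n m (ℕ.m⊔n≤o⇒m≤o N K r) (ℕ.m⊔n≤o⇒m≤o N K l)))
  where
  inverse : ∀ n → ∃ λ i → 0ℚ ℚ.< i × (seq x n ℚ.⊔ e) ℚ.* i ≡ 1ℚ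
  inverse n = reciprocal (seq x n ℚ.⊔ e) (0<⊔ 0<e (seq x n))
  above : ∀ n → K ℕ.≤ n → seq x n ℚ.⊔ e ≡ seq x n
  above n K≤n = ℚ.p≥q⇒p⊔q≡p (subst (ℚ._≤ seq x n) (ℚ.+-identityˡ e) (hK n K≤n))

Σ∈ : {A : Set} → List A → (A → ℝ) → ℝ
Σ∈ xs g = List.foldr (λ x s → g x + s) 0ℝ xs

∏ : ∀ {n} → Vec ℝ n → ℝ
∏ = Vec.foldr′ _*_ 1ℝ

------------------------------------------------------------------------
-- {-1, 1} is represented by Sign.

Cube : ℕ → Set
Cube n = Vec Sign n

toℤ : Sign → ℤ
toℤ s = s ◃ 1

toℝ : Sign → ℝ
toℝ s = fromℚ (toℤ s ℚ./ 1)

vectors : {A : Set} → List A → (n : ℕ) → List (Vec A n)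
vectors xs zero    = [] ∷ []
vectors xs (suc n) = cartesianProductWith _∷_ xs (vectors xs n)

signs : List Sign
signs = Sign.+ ∷ Sign.- ∷ []

cube : (n : ℕ) → List (Cube n)
cube = vectors signs

uniform : ∀ {n} → Cube n → ℝ
uniform {n} _ = fromℚ ((+ 1 ℚ./ (2 ℕ.^ n)) {{ℕ.m^n≢0 2 n}})

Unbiased : ∀ {n} → (Cube n → Sign) → Set
Unbiased {n} f = Σ∈ (cube n) (λ x → uniform x * toℝ (f x)) ≈ 0ℝ

IncreasingIn DecreasingIn : ∀ {n} → Fin n → (Cube n → Sign) → Set
IncreasingIn i f = ∀ x s t → toℤ s ℤ.≤ toℤ t → toℤ (f (x [ i ]≔ s)) ℤ.≤ toℤ (f (x [ i ]≔ t))
DecreasingIn i f = ∀ x s t → toℤ s ℤ.≤ toℤ t → toℤ (f (x [ i ]≔ t)) ℤ.≤ toℤ (f (x [ i ]≔ s))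

Unate : ∀ {n} → (Cube n → Sign) → Set
Unate f = ∀ i → IncreasingIn i f ⊎ DecreasingIn i f

-- ℤ.sign sends 0 to Sign.+, but the sum is never 0 when n is odd.
Maj : (n : ℕ) → Cube n → Sign
Maj n x = ℤ.sign (Vec.foldr′ ℤ._+_ 0ℤ (Vec.map toℤ x))

MajUpToFlips : ∀ {n} → (Cube n → Sign) → Set
MajUpToFlips {n} f = ∃ λ (a : Cube n) → ∀ x → f x ≡ Maj n (zipWith Sign._*_ a x)

------------------------------------------------------------------------
-- Distributions are given by their mass functions.

-- The law of n independent pairs, as a joint law of two vectors.
_^⊗ : {A B : Set} → (A → B → ℝ) → ∀ {n} → Vec A n → Vec B n → ℝ
(μ ^⊗) x y = ∏ (zipWith μ x y)

DSBS : ℝ → Sign → Sign → ℝ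
DSBS ρ Sign.+ Sign.+ = fromℚ (+ 1 ℚ./ 4) * (1ℝ + ρ)
DSBS ρ Sign.- Sign.- = fromℚ (+ 1 ℚ./ 4) * (1ℝ + ρ)
DSBS ρ Sign.+ Sign.- = fromℚ (+ 1 ℚ./ 4) * (1ℝ - ρ)
DSBS ρ Sign.- Sign.+ = fromℚ (+ 1 ℚ./ 4) * (1ℝ - ρ)

Stab : ∀ {n} → ℝ → (Cube n → Sign) → ℝ
Stab {n} ρ f = Σ∈ (cube n) λ x → Σ∈ (cube n) λ y →
  (DSBS ρ ^⊗) x y * (toℝ (f x) * toℝ (f y))

-- {-1, 1, ⋆}, with nothing for the erasure ⋆.
Erased : Set
Erased = Maybe Sign

SBES : ℝ → Sign → Erased → ℝ
SBES p Sign.+ (just Sign.+) = fromℚ ½ * p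
SBES p Sign.- (just Sign.-) = fromℚ ½ * p
SBES p Sign.+ (just Sign.-) = 0ℝ
SBES p Sign.- (just Sign.+) = 0ℝ
SBES p _      nothing       = fromℚ ½ * (1ℝ - p)

erasedCube : (n : ℕ) → List (Vec Erased n)
erasedCube = vectors (nothing ∷ List.map just signs)

PrY : ∀ {n} → ℝ → Vec Erased n → ℝ
PrY {n} p y = Σ∈ (cube n) λ x → (SBES p ^⊗) x y

-- Termwise, hence stronger than 0ℝ ≤ x.
Nonneg : ℝ → Set
Nonneg x = Eventually λ n → 0ℚ ℚ.≤ seq x n

pos⇒nonneg : ∀ {x} → 0ℝ < x → Nonneg x
pos⇒nonneg {x} (e , 0<e , h) = ev-map
  (λ n le → ℚ.≤-trans (ℚ.<⇒≤ 0<e) (subst (ℚ._≤ seq x n) (ℚ.+-identityˡ e) le)) h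

nonneg-* : ∀ {x y} → Nonneg x → Nonneg y → Nonneg (x * y)
nonneg-* h k = ev-map (λ n (a , b) → *-nonneg a b) (ev-∩ h k)

nonneg-+ : ∀ {x y} → Nonneg x → Nonneg y → Nonneg (x + y)
nonneg-+ h k = ev-map (λ n (a , b) → ℚ.+-mono-≤ a b) (ev-∩ h k)

pos-* : ∀ {x y} → 0ℝ < x → 0ℝ < y → 0ℝ < x * y
pos-* {x} {y} (d , 0<d , h) (e , 0<e , k) = d ℚ.* e , *-pos 0<d 0<e , ev-map
  (λ n (a , b) → subst (ℚ._≤ seq x n ℚ.* seq y n) (sym (ℚ.+-identityˡ (d ℚ.* e)))
    (let d≤x = subst (ℚ._≤ seq x n) (ℚ.+-identityˡ d) a
         e≤y = subst (ℚ._≤ seq y n) (ℚ.+-identityˡ e) b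
     in *-mono-≤ (ℚ.≤-trans (ℚ.<⇒≤ 0<d) d≤x) (ℚ.<⇒≤ 0<e) d≤x e≤y))
  (ev-∩ h k)

pos+nonneg : ∀ {x y} → 0ℝ < x → Nonneg y → 0ℝ < x + y
pos+nonneg {x} {y} (e , 0<e , h) k = e , 0<e , ev-map
  (λ n (a , b) → subst (ℚ._≤ seq x n ℚ.+ seq y n) (ℚ.+-identityʳ (0ℚ ℚ.+ e)) (ℚ.+-mono-≤ a b))
  (ev-∩ h k)

nonneg+pos : ∀ {x y} → Nonneg x → 0ℝ < y → 0ℝ < x + y
nonneg+pos {x} {y} k (e , 0<e , h) = e , 0<e , ev-map
  (λ n (a , b) → subst (ℚ._≤ seq x n ℚ.+ seq y n) (ℚ.+-identityˡ (0ℚ ℚ.+ e)) (ℚ.+-mono-≤ b a))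
  (ev-∩ h k)

pos-fromℚ : ∀ {q} → 0ℚ ℚ.< q → 0ℝ < fromℚ q
pos-fromℚ {q} 0<q = q , 0<q , 0 , λ _ _ → ℚ.≤-reflexive (ℚ.+-identityˡ q)

pos-1- : ∀ {p} → p < 1ℝ → 0ℝ < 1ℝ - p
pos-1- {p} (e , 0<e , h) = e , 0<e , ev-map
  (λ n le → subst (ℚ._≤ 1ℚ ℚ.- seq p n)
    (trans (a+b-a≡b (seq p n) e) (sym (ℚ.+-identityˡ e)))
    (ℚ.+-monoˡ-≤ (ℚ.- seq p n) le)) h

Σ-nonneg : {A : Set} (xs : List A) (g : A → ℝ) → (∀ x → Nonneg (g x)) → Nonneg (Σ∈ xs g)
Σ-nonneg []       g h = 0 , λ _ _ → ℚ.≤-refl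
Σ-nonneg (x ∷ xs) g h = nonneg-+ {g x} {Σ∈ xs g} (h x) (Σ-nonneg xs g h)

Σ-pos : {A : Set} {xs : List A} {x : A} (g : A → ℝ) → (∀ x → Nonneg (g x)) →
        x ∈ xs → 0ℝ < g x → 0ℝ < Σ∈ xs g
Σ-pos {xs = _ ∷ xs} {x} g h (here refl) 0<gx =
  pos+nonneg {g x} {Σ∈ xs g} 0<gx (Σ-nonneg xs g h)
Σ-pos {xs = z ∷ xs} g h (there x∈xs) 0<gx =
  nonneg+pos {g z} {Σ∈ xs g} (h z) (Σ-pos g h x∈xs 0<gx)

∈-cube : ∀ {n} (x : Cube n) → x ∈ cube n
∈-cube []      = here refl
∈-cube (s ∷ x) = ∈-cartesianProductWith⁺ _∷_ (∈-signs s) (∈-cube x)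
  where
  ∈-signs : ∀ s → s ∈ signs
  ∈-signs Sign.+ = here refl
  ∈-signs Sign.- = there (here refl)

-- The bounds on p make every PrY p y positive, so that conditioning on y is
-- division by PrY p y.
module _ (p : ℝ) (0<p : 0ℝ < p) (p<1 : p < 1ℝ) where
  ½p : 0ℝ < fromℚ ½ * p
  ½p = pos-* {fromℚ ½} {p} (pos-fromℚ (ℚ.positive⁻¹ ½)) 0<p

  ½[1-p] : 0ℝ < fromℚ ½ * (1ℝ - p)
  ½[1-p] = pos-* {fromℚ ½} {1ℝ - p} (pos-fromℚ (ℚ.positive⁻¹ ½)) (pos-1- {p} p<1)

  SBES-nonneg : ∀ s e → Nonneg (SBES p s e)
  SBES-nonneg Sign.+ (just Sign.+) = pos⇒nonneg {fromℚ ½ * p} ½p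
  SBES-nonneg Sign.- (just Sign.-) = pos⇒nonneg {fromℚ ½ * p} ½p
  SBES-nonneg Sign.+ (just Sign.-) = 0 , λ _ _ → ℚ.≤-refl
  SBES-nonneg Sign.- (just Sign.+) = 0 , λ _ _ → ℚ.≤-refl
  SBES-nonneg Sign.+ nothing       = pos⇒nonneg {fromℚ ½ * (1ℝ - p)} ½[1-p]
  SBES-nonneg Sign.- nothing       = pos⇒nonneg {fromℚ ½ * (1ℝ - p)} ½[1-p]

  SBES-pos : ∀ e → 0ℝ < SBES p (fromMaybe Sign.+ e) e
  SBES-pos (just Sign.+) = ½p
  SBES-pos (just Sign.-) = ½p
  SBES-pos nothing       = ½[1-p]

  ⊗-nonneg : ∀ {n} (y : Vec Erased n) x → Nonneg ((SBES p ^⊗) x y)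
  ⊗-nonneg []      []      = 0 , λ _ _ → ℚ.nonNegative⁻¹ 1ℚ
  ⊗-nonneg (e ∷ y) (s ∷ x) =
    nonneg-* {SBES p s e} {(SBES p ^⊗) x y} (SBES-nonneg s e) (⊗-nonneg y x)

  ⊗-pos : ∀ {n} (y : Vec Erased n) → 0ℝ < (SBES p ^⊗) (Vec.map (fromMaybe Sign.+) y) y
  ⊗-pos []      = pos-fromℚ (ℚ.positive⁻¹ 1ℚ)
  ⊗-pos (e ∷ y) = pos-* {SBES p (fromMaybe Sign.+ e) e}
    {(SBES p ^⊗) (Vec.map (fromMaybe Sign.+) y) y} (SBES-pos e) (⊗-pos y)

  PrY-pos : ∀ {n} (y : Vec Erased n) → 0ℝ < PrY p y
  PrY-pos y = Σ-pos {x = x₀} (λ x → (SBES p ^⊗) x y) (⊗-nonneg y) (∈-cube x₀) (⊗-pos y)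
    where x₀ = Vec.map (fromMaybe Sign.+) y

  PrX∣Y : ∀ {n} → Cube n → Vec Erased n → ℝ
  PrX∣Y x y = (SBES p ^⊗) x y * recip (PrY p y) (PrY-pos y)

  𝔼[_∣Y=_] : ∀ {n} → (Cube n → Sign) → Vec Erased n → ℝ
  𝔼[_∣Y=_] {n} f y = Σ∈ (cube n) λ x → PrX∣Y x y * toℝ (f x)

  Φ : ∀ {n} → (Cube n → Sign) → ℝ
  Φ {n} f = Σ∈ (erasedCube n) λ y → PrY p y * abs 𝔼[ f ∣Y= y ]

------------------------------------------------------------------------
-- The thresholds; the value 0 for n ≤ 1, where a denominator vanishes, is
-- a placeholder.

γ γ′ : ℕ → ℚ
γ n@(suc (suc _)) = + 4 ℚ./ ((n ℕ.+ 7) ℕ.* (n ℕ.∸ 1))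
γ _               = 0ℚ
γ′ n@(suc (suc _)) = + 2 ℚ./ ((n ℕ.+ 2) ℕ.* (n ℕ.∸ 1))
γ′ _               = 0ℚ

a/b≤1 : ∀ a b → a ℕ.≤ suc b → + a ℚ./ suc b ℚ.≤ 1ℚ
a/b≤1 a b a≤b = ℚ.toℚᵘ-cancel-≤ (begin
  ℚ.toℚᵘ (+ a ℚ./ suc b)   ≃⟨ ℚ.toℚᵘ-fromℚᵘ (ℚᵘ.mkℚᵘ (+ a) b) ⟩
  ℚᵘ.mkℚᵘ (+ a) b          ≤⟨ ℚᵘ.*≤* (subst₂ ℤ._≤_
    (sym (ℤ.*-identityʳ (+ a))) (sym (ℤ.*-identityˡ (+ suc b))) (ℤ.+≤+ a≤b)) ⟩
  ℚᵘ.1ℚᵘ                   ∎)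
  where open ℚᵘ.≤-Reasoning

0≤1 : 0ℚ ℚ.≤ 1ℚ
0≤1 = ℚ.nonNegative⁻¹ 1ℚ

<q⇒<1 : ∀ {q p} → q ℚ.≤ 1ℚ → p < fromℚ q → p < 1ℝ
<q⇒<1 q≤1 (e , 0<e , h) = e , 0<e , ev-map (λ n le → ℚ.≤-trans le q≤1) h

γ≤1 : ∀ n → γ n ℚ.≤ 1ℚ
γ≤1 0             = 0≤1
γ≤1 1             = 0≤1
γ≤1 (suc (suc k)) = a/b≤1 4 _ (ℕ.≤-trans (ℕ.m≤n+m 4 (5 ℕ.+ k))
  (ℕ.≤-trans (ℕ.≤-reflexive (lem k)) (ℕ.m≤m*n (2 ℕ.+ k ℕ.+ 7) (suc k))))
  where
  lem : ∀ k → 5 ℕ.+ k ℕ.+ 4 ≡ 2 ℕ.+ k ℕ.+ 7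
  lem k = trans (ℕ.+-assoc 5 k 4) (trans (cong (5 ℕ.+_) (ℕ.+-comm k 4))
    (trans (cong (2 ℕ.+_) (ℕ.+-comm 7 k)) (sym (ℕ.+-assoc 2 k 7))))

γ′≤1 : ∀ n → γ′ n ℚ.≤ 1ℚ
γ′≤1 0             = 0≤1
γ′≤1 1             = 0≤1
γ′≤1 (suc (suc k)) = a/b≤1 2 _ (ℕ.≤-trans (ℕ.m≤n+m 2 (2 ℕ.+ k))
  (ℕ.m≤m*n (2 ℕ.+ k ℕ.+ 2) (suc k)))

<γ⇒<1 : ∀ n p → p < fromℚ (γ n) → p < 1ℝ
<γ⇒<1 n p = <q⇒<1 {p = p} (γ≤1 n)

<γ′⇒<1 : ∀ n p → p < fromℚ (γ′ n) → p < 1ℝ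
<γ′⇒<1 n p = <q⇒<1 {p = p} (γ′≤1 n)

Vanishing : (ℕ → ℚ) → Set
Vanishing δ = ∀ ε → 0ℚ ℚ.< ε → Eventually λ n → ∣ δ n ∣ ℚ.≤ ε

{-# OPTIONS --safe #-}
module Submission where

-- Flip coordinates so that f is monotone (or, for general f, so that all its
-- degree-one Fourier coefficients are nonnegative), let M = Maj, and let y be a
-- noisy or erased copy of x, each coordinate being changed or revealed with
-- probability q. Consider a point x where f and M differ. If the coordinates of
-- x that are changed or revealed all have the same sign σ, then monotonicity
-- determines the absolute values involved up to the sign σ, so that y adds
-- σ M(x) per unit of |f(x) − M(x)| to the advantage of M; in any other case it
-- costs at most 1. Averaging over y, with v = 1 − q and N the number of
-- coordinates of x different from M(x), the advantage is at least
--   2 v^N − 1 − v^n,   where N ≤ k for n = 2k + 1,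
-- which is at least q (1 − k(k+2) q), whereas γ = 1/(k(k+4)). For general f only
-- a single revealed coordinate is controlled, and the advantage becomes
--   2 (n − N) q v^(n−1) − 1 + v^n ≥ q (1 − k(2k+3) q), with γ′ = 1/(k(2k+3)).

open import Data.Nat as ℕ using (ℕ; zero; suc; _%_)
import Data.Nat.Properties as ℕ
open import Data.Nat.DivMod using (m≡m%n+[m/n]*n)
open import Data.Integer as ℤ using ()
import Data.Integer.Properties as ℤ
open import Data.Rational as ℚ using (ℚ; 0ℚ; 1ℚ; ½; ∣_∣)
import Data.Rational.Properties as ℚ
open import Data.Rational.Solver using (module +-*-Solver)
open import Data.Bool using (Bool; true; false; if_then_else_; _∧_; _∨_; T)
import Data.Bool.Properties as Bool
open import Data.Sign as Sign using (Sign; opposite)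
import Data.Sign.Properties as SignP
open import Data.Maybe as Maybe using (just; nothing)
open import Data.Fin using (Fin; zero; suc)
open import Data.List as List using (List; []; _∷_)
open import Data.List.Membership.Propositional using (_∈_)
open import Data.List.Relation.Unary.All as All using ()
open import Data.List.Relation.Unary.All.Properties using (¬All⇒Any¬)
open import Data.List.Relation.Unary.Any as Any using (here; there)
open import Data.Vec as Vec using (Vec; []; _∷_; zipWith; replicate; _[_]≔_)
import Data.Vec.Properties as VecP
open import Data.Vec.Relation.Binary.Pointwise.Inductive as Pointwise using (Pointwise; []; _∷_)
open import Data.Product using (∃; _×_; _,_; proj₁; proj₂)
open import Data.Sum using (inj₁; inj₂)
open import Function using (_∘_)
open import Relation.Nullary using (¬_; Dec; yes; no; contradiction)
open import Relation.Nullary.Decidable using (_→-dec_; from-yes; T?)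
open import Relation.Binary.PropositionalEquality
  using (_≡_; _≢_; refl; sym; trans; cong; cong₂; subst; subst₂; module ≡-Reasoning)

open +-*-Solver using (solve; con; _:+_; _:*_; _:-_; _:=_; :-_)

-- The obstacle is the absolute value around the conditional mean of f. Once its sign σ is known, |A
-- f y| is σ `A f y`, while σ `A M y` is at most |A M y| whatever the sign of `A M y`; so the
-- comparison becomes linear in M - f and no information on the mean of M enters. The sign σ comes
-- from unbiasedness: f has mean zero on the whole cube, and restricting to a face fixed by the
-- revealed signs moves this mean in a known direction. Everything is proved for rational
-- parameters. The real operations act termwise on Cauchy sequences, so at late indices `Stab` and
-- `Φ` are the same finite sums evaluated at a rational approximation of the parameter. A strict
-- inequality of reals then needs a gap that does not shrink with the index. It is a product of
-- three bounds: the approximations stay at a fixed distance from both ends of the parameter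
-- interval, each point has weight `½ ^ n`, and a function that is not majority up to flips has
-- `distance` at least 1 from it after every flip.

module Finite where
  open import Defs using
    ( Cube; Erased; vectors; cube; signs; erasedCube; toℤ; Maj; MajUpToFlips; ∈-cube
    ; Unate; IncreasingIn; γ; γ′; Vanishing; *-pos; *-nonneg; *-mono-≤; 0≤∣_∣)
  open import Data.Integer using (_⊖_)
  open import Data.List using (foldr; map; _++_; cartesianProductWith)
  open import Data.Rational using (mkℚ; toℚᵘ; positive; nonNegative; _+_; _-_; _*_; -_; _/_; _≤_; _<_)
  import Data.Rational.Unnormalised as ℚᵘ
  import Data.Rational.Unnormalised.Properties as ℚᵘ

  -- Rational inequalities and finite sums

  2ℚ : ℚ
  2ℚ = 1ℚ + 1ℚ

  -- Exhibiting the nonnegative slack `d` reduces a polynomial inequality to an identity for the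
  -- ring solver.
  ≤-by : ∀ {a b} d → 0ℚ ≤ d → b ≡ a + d → a ≤ b
  ≤-by {a} d 0≤d b≡a+d = ℚ.≤-trans (ℚ.≤-reflexive (sym (ℚ.+-identityʳ a)))
    (ℚ.≤-trans (ℚ.+-monoʳ-≤ a 0≤d) (ℚ.≤-reflexive (sym b≡a+d)))

  ≤⇒0≤- : ∀ {a b} → a ≤ b → 0ℚ ≤ b - a
  ≤⇒0≤- {a} {b} a≤b = ℚ.≤-trans (ℚ.≤-reflexive (sym (ℚ.+-inverseʳ a))) (ℚ.+-monoˡ-≤ (- a) a≤b)

  +-nonneg : ∀ {a b} → 0ℚ ≤ a → 0ℚ ≤ b → 0ℚ ≤ a + b
  +-nonneg = ℚ.+-mono-≤

  *-monoˡ : ∀ {c a b} → 0ℚ ≤ c → a ≤ b → c * a ≤ c * b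
  *-monoˡ {c} 0≤c = ℚ.*-monoˡ-≤-nonNeg c {{nonNegative 0≤c}}

  x≤∣x∣ : ∀ x → x ≤ ∣ x ∣
  x≤∣x∣ x with ℚ.≤-total 0ℚ x
  ... | inj₁ 0≤x = ℚ.≤-reflexive (sym (ℚ.0≤p⇒∣p∣≡p 0≤x))
  ... | inj₂ x≤0 = ℚ.≤-trans x≤0 (0≤∣ x ∣)

  ∑ : {A : Set} → List A → (A → ℚ) → ℚ
  ∑ xs g = foldr (λ x s → g x + s) 0ℚ xs

  module _ {A : Set} where
    ∑-cong : ∀ (xs : List A) {g h} → (∀ x → g x ≡ h x) → ∑ xs g ≡ ∑ xs h
    ∑-cong []       eq = refl
    ∑-cong (x ∷ xs) eq = cong₂ _+_ (eq x) (∑-cong xs eq)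

    ∑-mono : ∀ (xs : List A) {g h} → (∀ x → g x ≤ h x) → ∑ xs g ≤ ∑ xs h
    ∑-mono []       le = ℚ.≤-refl
    ∑-mono (x ∷ xs) le = ℚ.+-mono-≤ (le x) (∑-mono xs le)

    ∑-zero : ∀ (xs : List A) → ∑ xs (λ _ → 0ℚ) ≡ 0ℚ
    ∑-zero []       = refl
    ∑-zero (x ∷ xs) = trans (ℚ.+-identityˡ _) (∑-zero xs)

    ∑-nonneg : ∀ (xs : List A) {g} → (∀ x → 0ℚ ≤ g x) → 0ℚ ≤ ∑ xs g
    ∑-nonneg xs {g} le = subst (_≤ ∑ xs g) (∑-zero xs) (∑-mono xs le)

    ∑-+ : ∀ (xs : List A) g h → ∑ xs (λ x → g x + h x) ≡ ∑ xs g + ∑ xs h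
    ∑-+ []       g h = refl
    ∑-+ (x ∷ xs) g h = trans (cong (g x + h x +_) (∑-+ xs g h))
      (solve 4 (λ a b c d → (a :+ b) :+ (c :+ d) := (a :+ c) :+ (b :+ d)) refl
        (g x) (h x) (∑ xs g) (∑ xs h))

    ∑-* : ∀ (xs : List A) c g → ∑ xs (λ x → c * g x) ≡ c * ∑ xs g
    ∑-* []       c g = sym (ℚ.*-zeroʳ c)
    ∑-* (x ∷ xs) c g = trans (cong (c * g x +_) (∑-* xs c g)) (sym (ℚ.*-distribˡ-+ c _ _))

    ∑-neg : ∀ (xs : List A) g → ∑ xs (λ x → - g x) ≡ - ∑ xs g
    ∑-neg []       g = refl
    ∑-neg (x ∷ xs) g = trans (cong (- g x +_) (∑-neg xs g)) (sym (ℚ.neg-distrib-+ (g x) _))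

    ∑-- : ∀ (xs : List A) g h → ∑ xs (λ x → g x - h x) ≡ ∑ xs g - ∑ xs h
    ∑-- xs g h = trans (∑-+ xs g (λ x → - h x)) (cong (∑ xs g +_) (∑-neg xs h))

    ∑-++ : ∀ (xs ys : List A) g → ∑ (xs ++ ys) g ≡ ∑ xs g + ∑ ys g
    ∑-++ []       ys g = sym (ℚ.+-identityˡ _)
    ∑-++ (x ∷ xs) ys g = trans (cong (g x +_) (∑-++ xs ys g)) (sym (ℚ.+-assoc (g x) _ _))

    ∑-map : ∀ {B : Set} (φ : A → B) xs g → ∑ (map φ xs) g ≡ ∑ xs (g ∘ φ)
    ∑-map φ []       g = refl
    ∑-map φ (x ∷ xs) g = cong (g (φ x) +_) (∑-map φ xs g)

    term≤∑ : ∀ {xs : List A} {x} g → (∀ x → 0ℚ ≤ g x) → x ∈ xs → g x ≤ ∑ xs g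
    term≤∑ {_ ∷ xs} g 0≤g (here refl)  = ≤-by (∑ xs g) (∑-nonneg xs 0≤g) refl
    term≤∑ {y ∷ xs} {x} g 0≤g (there i) = ≤-by (g y + (∑ xs g - g x))
      (+-nonneg (0≤g y) (≤⇒0≤- (term≤∑ g 0≤g i)))
      (solve 3 (λ a b c → b :+ c := a :+ (b :+ (c :- a))) refl (g x) (g y) (∑ xs g))

    ∣∑∣≤∑∣∣ : ∀ (xs : List A) g → ∣ ∑ xs g ∣ ≤ ∑ xs (∣_∣ ∘ g)
    ∣∑∣≤∑∣∣ []       g = ℚ.≤-refl
    ∣∑∣≤∑∣∣ (x ∷ xs) g = ℚ.≤-trans (ℚ.∣p+q∣≤∣p∣+∣q∣ (g x) _) (ℚ.+-monoʳ-≤ ∣ g x ∣ (∣∑∣≤∑∣∣ xs g))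

  -- Sums over cubes and product kernels

  ∑-swap : {A B : Set} (xs : List A) (ys : List B) (g : A → B → ℚ) →
           ∑ xs (λ x → ∑ ys (g x)) ≡ ∑ ys (λ y → ∑ xs (λ x → g x y))
  ∑-swap []       ys g = sym (∑-zero ys)
  ∑-swap (x ∷ xs) ys g = trans (cong (∑ ys (g x) +_) (∑-swap xs ys g))
    (sym (∑-+ ys (g x) (λ y → ∑ xs (λ x → g x y))))

  ∑-vectors : {A : Set} (es : List A) (n : ℕ) (g : Vec A (suc n) → ℚ) →
              ∑ (vectors es (suc n)) g ≡ ∑ es (λ e → ∑ (vectors es n) (λ v → g (e ∷ v)))
  ∑-vectors {A} es n g = product es
    where
    product : ∀ ds → ∑ (cartesianProductWith _∷_ ds (vectors es n)) g
                   ≡ ∑ ds (λ e → ∑ (vectors es n) (λ v → g (e ∷ v)))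
    product []       = refl
    product (d ∷ ds) = trans
      (∑-++ (map (d ∷_) (vectors es n)) (cartesianProductWith _∷_ ds (vectors es n)) g)
      (cong₂ _+_ (∑-map (d ∷_) (vectors es n) g) (product ds))

  ∑-cube : ∀ n (g : Cube (suc n) → ℚ) → ∑ (cube (suc n)) g ≡
           ∑ (cube n) (λ x → g (Sign.+ ∷ x)) + ∑ (cube n) (λ x → g (Sign.- ∷ x))
  ∑-cube n g = trans (∑-vectors signs n g) (cong (∑ (cube n) (λ x → g (Sign.+ ∷ x)) +_) (ℚ.+-identityʳ _))

  Π : ∀ {n} → (Sign → ℚ) → Cube n → ℚ
  Π r []      = 1ℚ
  Π r (s ∷ x) = r s * Π r x

  -- Distributivity: the sum over all vectors factors into the row sums `r`. Taking `F` to be a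
  -- kernel times an indicator gives the probability of any event that is tested coordinate by
  -- coordinate.
  ∑-multiplicative : {E : Set} (es : List E) (F : ∀ {n} → Cube n → Vec E n → ℚ)
    (c : Sign → E → ℚ) (r : Sign → ℚ) → F [] [] ≡ 1ℚ →
    (∀ {n} s e (x : Cube n) y → F (s ∷ x) (e ∷ y) ≡ c s e * F x y) →
    (∀ s → ∑ es (c s) ≡ r s) →
    ∀ {n} (x : Cube n) → ∑ (vectors es n) (F x) ≡ Π r x
  ∑-multiplicative es F c r base step row []      = trans (ℚ.+-identityʳ _) base
  ∑-multiplicative es F c r base step row {suc n} (s ∷ x) = begin
    ∑ (vectors es (suc n)) (F (s ∷ x))                         ≡⟨ ∑-vectors es n (F (s ∷ x)) ⟩
    ∑ es (λ e → ∑ (vectors es n) (λ y → F (s ∷ x) (e ∷ y)))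
      ≡⟨ ∑-cong es (λ e → trans (∑-cong (vectors es n) (step s e x)) (∑-* (vectors es n) (c s e) (F x))) ⟩
    ∑ es (λ e → c s e * ∑ (vectors es n) (F x))
      ≡⟨ ∑-cong es (λ e → trans (cong (c s e *_) (∑-multiplicative es F c r base step row x)) (ℚ.*-comm (c s e) _)) ⟩
    ∑ es (λ e → Π r x * c s e)                                 ≡⟨ ∑-* es (Π r x) (c s) ⟩
    Π r x * ∑ es (c s)                                         ≡⟨ cong (Π r x *_) (row s) ⟩
    Π r x * r s                                                ≡⟨ ℚ.*-comm _ (r s) ⟩
    r s * Π r x                                                ∎
    where open ≡-Reasoning

  ⨂ : {E : Set} → (Sign → E → ℚ) → ∀ {n} → Cube n → Vec E n → ℚ
  ⨂ k []      []      = 1ℚ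
  ⨂ k (s ∷ x) (e ∷ y) = k s e * ⨂ k x y

  ⨂-nonneg : {E : Set} {k : Sign → E → ℚ} → (∀ s e → 0ℚ ≤ k s e) →
             ∀ {n} (x : Cube n) y → 0ℚ ≤ ⨂ k x y
  ⨂-nonneg 0≤k []      []      = ℚ.nonNegative⁻¹ 1ℚ
  ⨂-nonneg 0≤k (s ∷ x) (e ∷ y) = *-nonneg (0≤k s e) (⨂-nonneg 0≤k x y)

  ⨂-sym : ∀ {k : Sign → Sign → ℚ} → (∀ s t → k s t ≡ k t s) →
          ∀ {n} (x y : Cube n) → ⨂ k x y ≡ ⨂ k y x
  ⨂-sym k-sym []      []      = refl
  ⨂-sym k-sym (s ∷ x) (t ∷ y) = cong₂ _*_ (k-sym s t) (⨂-sym k-sym x y)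

  𝟙 : Bool → ℚ
  𝟙 b = if b then 1ℚ else 0ℚ

  𝟙-∧ : ∀ k w a b → (k * w) * 𝟙 (a ∧ b) ≡ (k * 𝟙 a) * (w * 𝟙 b)
  𝟙-∧ k w true  b = solve 3 (λ k w t → (k :* w) :* t := (k :* con 1ℚ) :* (w :* t)) refl k w (𝟙 b)
  𝟙-∧ k w false b = solve 3 (λ k w t → (k :* w) :* con 0ℚ := (k :* con 0ℚ) :* (w :* t)) refl k w (𝟙 b)

  ⟦_⟧ : Sign → ℚ
  ⟦ s ⟧ = toℤ s / 1

  flip : ∀ {n} → Cube n → Cube n → Cube n
  flip = zipWith Sign._*_

  -- Invariance under coordinate flips

  module Reindex {E : Set} (es : List E) (act : Sign → E → E)
    (∑-act : ∀ s (g : E → ℚ) → ∑ es (λ e → g (act s e)) ≡ ∑ es g) where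

    -- Each `act s` permutes the alphabet, so a flip permutes the vectors. The alphabet is a
    -- parameter because the two channels have different outputs.
    ∑-flip : ∀ {n} (a : Cube n) (g : Vec E n → ℚ) →
             ∑ (vectors es n) (λ y → g (zipWith act a y)) ≡ ∑ (vectors es n) g
    ∑-flip []      g = refl
    ∑-flip {suc n} (s ∷ a) g = begin
      ∑ (vectors es (suc n)) (λ y → g (zipWith act (s ∷ a) y))  ≡⟨ ∑-vectors es n (λ y → g (zipWith act (s ∷ a) y)) ⟩
      ∑ es (λ e → ∑ (vectors es n) (λ y → g (act s e ∷ zipWith act a y)))
        ≡⟨ ∑-cong es (λ e → ∑-flip a (λ y → g (act s e ∷ y))) ⟩
      ∑ es (λ e → ∑ (vectors es n) (λ y → g (act s e ∷ y)))
        ≡⟨ ∑-act s (λ e → ∑ (vectors es n) (λ y → g (e ∷ y))) ⟩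
      ∑ es (λ e → ∑ (vectors es n) (λ y → g (e ∷ y)))           ≡⟨ ∑-vectors es n g ⟨
      ∑ (vectors es (suc n)) g                                  ∎
      where open ≡-Reasoning

    ⨂-flip : ∀ {k : Sign → E → ℚ} → (∀ t s e → k (t Sign.* s) (act t e) ≡ k s e) →
             ∀ {n} (a x : Cube n) y → ⨂ k (flip a x) (zipWith act a y) ≡ ⨂ k x y
    ⨂-flip k-act []      []      []      = refl
    ⨂-flip k-act (t ∷ a) (s ∷ x) (e ∷ y) = cong₂ _*_ (k-act t s e) (⨂-flip k-act a x y)

  ∑-signs-act : ∀ s (g : Sign → ℚ) → ∑ signs (λ t → g (s Sign.* t)) ≡ ∑ signs g
  ∑-signs-act Sign.+ g = refl
  ∑-signs-act Sign.- g = solve 2 (λ a b → b :+ (a :+ con 0ℚ) := a :+ (b :+ con 0ℚ)) refl (g Sign.+) (g Sign.-)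

  actᵉ : Sign → Erased → Erased
  actᵉ s = Maybe.map (s Sign.*_)

  ∑-erased-act : ∀ s (g : Erased → ℚ) → let es = nothing ∷ List.map just signs in
                 ∑ es (λ e → g (actᵉ s e)) ≡ ∑ es g
  ∑-erased-act Sign.+ g = refl
  ∑-erased-act Sign.- g = cong (g nothing +_)
    (solve 2 (λ a b → b :+ (a :+ con 0ℚ) := a :+ (b :+ con 0ℚ)) refl (g (just Sign.+)) (g (just Sign.-)))

  open Reindex signs Sign._*_ ∑-signs-act public
  open Reindex (nothing ∷ List.map just signs) actᵉ ∑-erased-act public
    renaming (∑-flip to ∑-flipᵉ; ⨂-flip to ⨂-flipᵉ)

  flip-involutive : ∀ {n} (a x : Cube n) → flip a (flip a x) ≡ x
  flip-involutive []           []      = refl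
  flip-involutive (Sign.+ ∷ a) (s ∷ x) = cong (s ∷_) (flip-involutive a x)
  flip-involutive (Sign.- ∷ a) (s ∷ x) = cong₂ _∷_ (SignP.opposite-involutive s) (flip-involutive a x)

  -- Counting signs; majority and minority

  is : Sign → Sign → Bool
  is Sign.+ Sign.+ = true
  is Sign.- Sign.- = true
  is _      _      = false

  count : Sign → ∀ {n} → Cube n → ℕ
  count m []      = 0
  count m (s ∷ x) = if is m s then suc (count m x) else count m x

  count-total : ∀ m {n} (x : Cube n) → count m x ℕ.+ count (opposite m) x ≡ n
  count-total m      []           = refl
  count-total Sign.+ (Sign.+ ∷ x) = cong suc (count-total Sign.+ x)
  count-total Sign.+ (Sign.- ∷ x) = trans (ℕ.+-suc _ _) (cong suc (count-total Sign.+ x))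
  count-total Sign.- (Sign.+ ∷ x) = trans (ℕ.+-suc _ _) (cong suc (count-total Sign.- x))
  count-total Sign.- (Sign.- ∷ x) = cong suc (count-total Sign.- x)

  ∑-signs≡⊖ : ∀ {n} (x : Cube n) → Vec.foldr′ ℤ._+_ ℤ.0ℤ (Vec.map toℤ x) ≡ count Sign.+ x ⊖ count Sign.- x
  ∑-signs≡⊖ []           = refl
  ∑-signs≡⊖ (Sign.+ ∷ x) = trans (cong (ℤ._+_ ℤ.1ℤ) (∑-signs≡⊖ x)) (ℤ.distribʳ-⊖-+-pos 1 (count Sign.+ x) (count Sign.- x))
  ∑-signs≡⊖ (Sign.- ∷ x) = trans (cong (ℤ._+_ ℤ.-1ℤ) (∑-signs≡⊖ x)) (ℤ.distribʳ-⊖-+-neg 0 (count Sign.+ x) (count Sign.- x))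

  smaller-half : ∀ k {a b} → a ℕ.≤ b → b ℕ.+ a ≡ suc (k ℕ.+ k) → a ℕ.≤ k
  smaller-half k {a} {b} a≤b eq with a ℕ.≤? k
  ... | yes a≤k = a≤k
  ... | no  a≰k = contradiction (ℕ.+-mono-≤ (ℕ.≤-trans (ℕ.≰⇒> a≰k) a≤b) (ℕ.≰⇒> a≰k))
    (ℕ.<⇒≱ (ℕ.≤-reflexive (trans (cong suc eq) (sym (cong suc (ℕ.+-suc k k))))))

  -- The sum that `Maj` tests is the difference of the two counts, so the opposite of its sign has
  -- the smaller count; the counts add up to 2k + 1.
  Maj-minority : ∀ k (x : Cube (suc (k ℕ.+ k))) → count (opposite (Maj _ x)) x ℕ.≤ k
  Maj-minority k x rewrite ∑-signs≡⊖ x with count Sign.- x ℕ.≤? count Sign.+ x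
  ... | yes le rewrite ℤ.⊖-≥ le        = smaller-half k le (count-total Sign.+ x)
  ... | no  gt rewrite ℤ.sign-⊖-≰ gt   = smaller-half k (ℕ.<⇒≤ (ℕ.≰⇒> gt)) (count-total Sign.- x)

  Maj-majority : ∀ k (x : Cube (suc (k ℕ.+ k))) → suc k ℕ.≤ count (Maj _ x) x
  Maj-majority k x = ℕ.+-cancelʳ-≤ k (suc k) _
    (ℕ.≤-trans (ℕ.≤-reflexive (sym (count-total (Maj _ x) x))) (ℕ.+-monoʳ-≤ _ (Maj-minority k x)))

  -- Powers of 1 − q

  infixr 8 _^_
  _^_ : ℚ → ℕ → ℚ
  q ^ zero  = 1ℚ
  q ^ suc n = q * q ^ n

  ^-pos : ∀ {v} → 0ℚ < v → ∀ n → 0ℚ < v ^ n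
  ^-pos 0<v zero    = ℚ.positive⁻¹ 1ℚ
  ^-pos 0<v (suc n) = Defs.*-pos 0<v (^-pos 0<v n)

  ^-+ : ∀ v m n → v ^ (m ℕ.+ n) ≡ v ^ m * v ^ n
  ^-+ v zero    n = sym (ℚ.*-identityˡ _)
  ^-+ v (suc m) n = trans (cong (v *_) (^-+ v m n)) (sym (ℚ.*-assoc v _ _))

  -- The embedding of the naturals, by recursion so that `ι (suc n)` unfolds to `1ℚ + ι n` for the
  -- ring solver.
  ι : ℕ → ℚ
  ι zero    = 0ℚ
  ι (suc n) = 1ℚ + ι n

  ι-nonneg : ∀ n → 0ℚ ≤ ι n
  ι-nonneg zero    = ℚ.≤-refl
  ι-nonneg (suc n) = +-nonneg (ℚ.nonNegative⁻¹ 1ℚ) (ι-nonneg n)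

  ι-mono : ∀ {m n} → m ℕ.≤ n → ι m ≤ ι n
  ι-mono {n = n} ℕ.z≤n = ι-nonneg n
  ι-mono (ℕ.s≤s m≤n)   = ℚ.+-monoʳ-≤ 1ℚ (ι-mono m≤n)

  ι-+ : ∀ m n → ι (m ℕ.+ n) ≡ ι m + ι n
  ι-+ zero    n = sym (ℚ.+-identityˡ _)
  ι-+ (suc m) n = trans (cong (1ℚ +_) (ι-+ m n)) (sym (ℚ.+-assoc 1ℚ (ι m) (ι n)))

  ι-* : ∀ m n → ι (m ℕ.* n) ≡ ι m * ι n
  ι-* zero    n = sym (ℚ.*-zeroˡ (ι n))
  ι-* (suc m) n = trans (ι-+ n (m ℕ.* n)) (trans (cong (ι n +_) (ι-* m n))
    (solve 2 (λ m n → n :+ m :* n := (con 1ℚ :+ m) :* n) refl (ι m) (ι n)))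

  module Powers {q : ℚ} (0≤q : 0ℚ ≤ q) (q≤1 : q ≤ 1ℚ) where
    v : ℚ
    v = 1ℚ - q

    0≤v : 0ℚ ≤ v
    0≤v = ≤⇒0≤- q≤1

    0≤^ : ∀ n → 0ℚ ≤ v ^ n
    0≤^ zero    = ℚ.nonNegative⁻¹ 1ℚ
    0≤^ (suc n) = *-nonneg 0≤v (0≤^ n)

    ^-antitone : ∀ {m n} → m ℕ.≤ n → v ^ n ≤ v ^ m
    ^-antitone {n = zero}  ℕ.z≤n = ℚ.≤-refl
    ^-antitone {n = suc n} ℕ.z≤n = ℚ.≤-trans
      (≤-by (q * v ^ n) (*-nonneg 0≤q (0≤^ n))
        (solve 2 (λ q w → w := (con 1ℚ :- q) :* w :+ q :* w) refl q (v ^ n)))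
      (^-antitone {n = n} ℕ.z≤n)
    ^-antitone (ℕ.s≤s m≤n) = *-monoˡ 0≤v (^-antitone m≤n)

    ^≤1 : ∀ n → v ^ n ≤ 1ℚ
    ^≤1 n = ^-antitone {n = n} ℕ.z≤n

    bernoulli : ∀ n → 1ℚ - ι n * q ≤ v ^ n
    bernoulli zero    = ℚ.≤-reflexive (solve 1 (λ q → con 1ℚ :- con 0ℚ :* q := con 1ℚ) refl q)
    bernoulli (suc n) = ℚ.≤-trans
      (≤-by (ι n * (q * q)) (*-nonneg (ι-nonneg n) (*-nonneg 0≤q 0≤q))
        (solve 2 (λ q m → (con 1ℚ :- q) :* (con 1ℚ :- m :* q)
          := con 1ℚ :- (con 1ℚ :+ m) :* q :+ m :* (q :* q)) refl q (ι n)))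
      (*-monoˡ 0≤v (bernoulli n))

    -- Pr[Bin(n,q) ≤ 1] ≥ 1 − (n choose 2) q², for n = suc j.
    bonferroni : ∀ j → 1ℚ - ½ * (ι j * ι (suc j)) * (q * q) ≤ v ^ suc j + ι (suc j) * (q * v ^ j)
    bonferroni zero    = ℚ.≤-reflexive (solve 1 (λ q →
      con 1ℚ :- con ½ :* (con 0ℚ :* (con 1ℚ :+ con 0ℚ)) :* (q :* q)
      := (con 1ℚ :- q) :* con 1ℚ :+ (con 1ℚ :+ con 0ℚ) :* (q :* con 1ℚ)) refl q)
    -- One more trial lowers Pr[at most one success] by q Pr[exactly one success] = (j+1) q² v^j.
    -- This is at most (j+1) q², the amount by which the binomial coefficient times q² grows.
    bonferroni (suc j) = ≤-by
      (d + ι (suc j) * (q * q) * (1ℚ - v ^ j))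
      (+-nonneg (≤⇒0≤- (bonferroni j))
        (*-nonneg (*-nonneg (ι-nonneg (suc j)) (*-nonneg 0≤q 0≤q)) (≤⇒0≤- (^≤1 j))))
      (solve 3 (λ q m w → let p = con 1ℚ :- q ; m₁ = con 1ℚ :+ m in
        p :* (p :* w) :+ (con 1ℚ :+ m₁) :* (q :* (p :* w))
        := (con 1ℚ :- con ½ :* (m₁ :* (con 1ℚ :+ m₁)) :* (q :* q))
           :+ ((p :* w :+ m₁ :* (q :* w) :- (con 1ℚ :- con ½ :* (m :* m₁) :* (q :* q)))
               :+ m₁ :* (q :* q) :* (con 1ℚ :- w)))
        refl q (ι j) (v ^ j))
      where d = v ^ suc j + ι (suc j) * (q * v ^ j) - (1ℚ - ½ * (ι j * ι (suc j)) * (q * q))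

    -- With u = v^k, the right-hand side is at least 2u − 1 − (1−q)u² = q u² − (1−u)², and 1−u ≤ kq.
    pure-bound : ∀ k {N} → N ℕ.≤ k →
      q * (1ℚ - ι k * (ι k + 2ℚ) * q) ≤ 2ℚ * v ^ N - 1ℚ + - 1ℚ * v ^ suc (k ℕ.+ k)
    pure-bound k {N} N≤k = ≤-by
      (2ℚ * (v ^ N - u) + (2ℚ * q * (K * q - t) + (q * (t * t) + (K * q - t) * (K * q + t))))
      (+-nonneg (*-nonneg (ℚ.nonNegative⁻¹ 2ℚ) (≤⇒0≤- (^-antitone N≤k)))
        (+-nonneg (*-nonneg (*-nonneg (ℚ.nonNegative⁻¹ 2ℚ) 0≤q) 0≤Kq-t)
          (+-nonneg (*-nonneg 0≤q (*-nonneg 0≤t 0≤t)) (*-nonneg 0≤Kq-t (+-nonneg (*-nonneg (ι-nonneg k) 0≤q) 0≤t)))))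
      (trans (cong (λ w → 2ℚ * v ^ N - 1ℚ + - 1ℚ * (v * w)) (^-+ v k k))
        (solve 4 (λ q u w K → let t = con 1ℚ :- u in
          con 2ℚ :* w :- con 1ℚ :+ con (- 1ℚ) :* ((con 1ℚ :- q) :* (u :* u))
          := q :* (con 1ℚ :- K :* (K :+ con 2ℚ) :* q)
             :+ (con 2ℚ :* (w :- u) :+ (con 2ℚ :* q :* (K :* q :- t)
                  :+ (q :* (t :* t) :+ (K :* q :- t) :* (K :* q :+ t)))))
          refl q u (v ^ N) K))
      where
      K = ι k
      u = v ^ k
      t = 1ℚ - u
      0≤t : 0ℚ ≤ t
      0≤t = ≤⇒0≤- (^≤1 k)
      0≤Kq-t : 0ℚ ≤ K * q - t
      0≤Kq-t = subst (0ℚ ≤_) (solve 3 (λ q u K → u :- (con 1ℚ :- K :* q) := K :* q :- (con 1ℚ :- u)) refl q u K)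
        (≤⇒0≤- (bernoulli k))

    -- Since 2(k+1) = (2k+1) + 1, the right-hand side is at least Pr[Bin(2k+1, q) ≤ 1] - 1 + q
    -- v^(2k). `bonferroni` bounds the first two terms by -k(2k+1) q² and `bernoulli` the last by q
    -- - 2k q²; together they give the constant k(2k+3).
    single-bound : ∀ k {c} → suc k ℕ.≤ c →
      q * (1ℚ - ι k * (2ℚ * ι k + (2ℚ + 1ℚ)) * q)
        ≤ 2ℚ * (ι c * (q * v ^ (k ℕ.+ k))) - 1ℚ + 1ℚ * v ^ suc (k ℕ.+ k)
    single-bound k {c} k<c = ≤-by
      (2ℚ * ((ι c - ι (suc k)) * (q * w)) + (q * (w - (1ℚ - ι n * q)) + (v * w + ι (suc n) * (q * w) - (1ℚ - ½ * (ι n * ι (suc n)) * (q * q)))))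
      (+-nonneg (*-nonneg (ℚ.nonNegative⁻¹ 2ℚ) (*-nonneg (≤⇒0≤- (ι-mono k<c)) (*-nonneg 0≤q (0≤^ n))))
        (+-nonneg (*-nonneg 0≤q (≤⇒0≤- (bernoulli n))) (≤⇒0≤- (bonferroni n))))
      (trans
        (solve 4 (λ q c w K → let n = K :+ K ; n₁ = con 1ℚ :+ (K :+ K) in
          con 2ℚ :* (c :* (q :* w)) :- con 1ℚ :+ con 1ℚ :* ((con 1ℚ :- q) :* w)
          := q :* (con 1ℚ :- K :* (con 2ℚ :* K :+ con (2ℚ + 1ℚ)) :* q)
             :+ (con 2ℚ :* ((c :- (con 1ℚ :+ K)) :* (q :* w)) :+ (q :* (w :- (con 1ℚ :- n :* q))
                :+ ((con 1ℚ :- q) :* w :+ n₁ :* (q :* w) :- (con 1ℚ :- con ½ :* (n :* n₁) :* (q :* q))))))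
          refl q (ι c) w (ι k))
        (cong (λ z → q * (1ℚ - ι k * (2ℚ * ι k + (2ℚ + 1ℚ)) * q)
             + (2ℚ * ((ι c - (1ℚ + ι k)) * (q * w)) + (q * (w - (1ℚ - z * q))
                + (v * w + (1ℚ + z) * (q * w) - (1ℚ - ½ * (z * (1ℚ + z)) * (q * q))))))
          (sym (ι-+ k k))))
      where
      n = k ℕ.+ k
      w = v ^ n

  -- Here 1 - Bq ≥ B(g - q) ≥ B e′ ≥ e′. The bound is free of q, hence uniform over all
  -- approximations that keep the margins e and e′.
  below-threshold : ∀ {q e e′ B g} → 0ℚ ≤ e → 0ℚ ≤ e′ → 1ℚ ≤ B → B * g ≤ 1ℚ → e ≤ q → q + e′ ≤ g →
                    e * e′ ≤ q * (1ℚ - B * q)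
  below-threshold {q} {e} {e′} {B} {g} 0≤e 0≤e′ 1≤B Bg≤1 e≤q q+e′≤g = *-mono-≤ (ℚ.≤-trans 0≤e e≤q) 0≤e′ e≤q
    (≤-by ((1ℚ - B * g) + (B * (g - (q + e′)) + (B - 1ℚ) * e′))
      (+-nonneg (≤⇒0≤- Bg≤1) (+-nonneg (*-nonneg (ℚ.≤-trans (ℚ.nonNegative⁻¹ 1ℚ) 1≤B) (≤⇒0≤- q+e′≤g))
        (*-nonneg (≤⇒0≤- 1≤B) 0≤e′)))
      (solve 4 (λ q e B g → con 1ℚ :- B :* q
        := e :+ ((con 1ℚ :- B :* g) :+ (B :* (g :- (q :+ e)) :+ (B :- con 1ℚ) :* e))) refl q e′ B g))

  -- Monotone functions and disagreement between functions

  infix 4 _≤ₛ_ _⊑_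
  _≤ₛ_ : Sign → Sign → Set
  s ≤ₛ t = toℤ s ℤ.≤ toℤ t

  _⊑_ : ∀ {n} → Cube n → Cube n → Set
  _⊑_ = Pointwise _≤ₛ_

  ⊑-refl : ∀ {n} (x : Cube n) → x ⊑ x
  ⊑-refl x = Pointwise.refl ℤ.≤-refl

  Monotone : ∀ {n} → (Cube n → Sign) → Set
  Monotone f = ∀ {x y} → x ⊑ y → f x ≤ₛ f y

  Monotone-∷ : ∀ {n} {f : Cube (suc n) → Sign} → Monotone f → ∀ s → Monotone (f ∘ (s ∷_))
  Monotone-∷ mono s x⊑y = mono (ℤ.≤-refl ∷ x⊑y)

  ⟦⟧-mono : ∀ {s t} → s ≤ₛ t → ⟦ s ⟧ ≤ ⟦ t ⟧
  ⟦⟧-mono {Sign.+} {Sign.+} _ = ℚ.≤-refl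
  ⟦⟧-mono {Sign.-} {Sign.-} _ = ℚ.≤-refl
  ⟦⟧-mono {Sign.-} {Sign.+} _ = ℚ.p≤q⊔p 1ℚ ⟦ Sign.- ⟧
  ⟦⟧-mono {Sign.+} {Sign.-} ()

  total : ∀ {n} → (Cube n → Sign) → ℚ
  total {n} f = ∑ (cube n) (⟦_⟧ ∘ f)

  Δ : Sign → Sign → ℚ
  Δ s t = ∣ ⟦ s ⟧ - ⟦ t ⟧ ∣

  -- Trivial for equal signs, and distinct signs are opposite. This turns a sum of disagreements
  -- weighted by the sign of M into the linear quantity M - f.
  Δ*⟦⟧ : ∀ s t → Δ s t * ⟦ t ⟧ ≡ ⟦ t ⟧ - ⟦ s ⟧
  Δ*⟦⟧ Sign.+ Sign.+ = refl
  Δ*⟦⟧ Sign.+ Sign.- = refl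
  Δ*⟦⟧ Sign.- Sign.+ = refl
  Δ*⟦⟧ Sign.- Sign.- = refl

  distance : ∀ {n} → (Cube n → Sign) → (Cube n → Sign) → ℚ
  distance {n} f g = ∑ (cube n) (λ x → Δ (f x) (g x))

  ⟦-⟧* : ∀ a → ⟦ Sign.- ⟧ * a ≡ - a
  ⟦-⟧* = solve 1 (λ a → con (- 1ℚ) :* a := :- a) refl

  signed-abs : ∀ σ {a} → 0ℚ ≤ ⟦ σ ⟧ * a → ∣ a ∣ ≡ ⟦ σ ⟧ * a
  signed-abs Sign.+ {a} 0≤a  = trans (cong ∣_∣ (sym (ℚ.*-identityˡ a))) (ℚ.0≤p⇒∣p∣≡p 0≤a)
  signed-abs Sign.- {a} 0≤-a =
    trans (sym (ℚ.∣-p∣≡∣p∣ a)) (trans (cong ∣_∣ (sym (⟦-⟧* a))) (ℚ.0≤p⇒∣p∣≡p 0≤-a))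

  signed≤abs : ∀ σ a → ⟦ σ ⟧ * a ≤ ∣ a ∣
  signed≤abs Sign.+ a = subst (_≤ ∣ a ∣) (sym (ℚ.*-identityˡ a)) (x≤∣x∣ a)
  signed≤abs Sign.- a = subst₂ _≤_ (sym (⟦-⟧* a)) (ℚ.∣-p∣≡∣p∣ a) (x≤∣x∣ (- a))

  ∑-κ : {A : Set} (xs : List A) (w a b : A → ℚ) (s : ℚ) →
        ∑ xs (λ x → w x * (2ℚ * a x - 1ℚ + s * b x)) ≡
        2ℚ * ∑ xs (λ x → w x * a x) - ∑ xs w + s * ∑ xs (λ x → w x * b x)
  ∑-κ []       w a b s = solve 1 (λ s → con 0ℚ := con 2ℚ :* con 0ℚ :- con 0ℚ :+ s :* con 0ℚ) refl s
  ∑-κ (x ∷ xs) w a b s = trans (cong (w x * (2ℚ * a x - 1ℚ + s * b x) +_) (∑-κ xs w a b s))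
    (solve 7 (λ w a b s A W B →
      w :* (con 2ℚ :* a :- con 1ℚ :+ s :* b) :+ (con 2ℚ :* A :- W :+ s :* B)
      := con 2ℚ :* (w :* a :+ A) :- (w :+ W) :+ s :* (w :* b :+ B)) refl
      (w x) (a x) (b x) s _ _ _)

  ½^-pos : ∀ n → 0ℚ < ½ ^ n
  ½^-pos = ^-pos (ℚ.positive⁻¹ ½)

  ½^-nonneg : ∀ n → 0ℚ ≤ ½ ^ n
  ½^-nonneg n = ℚ.<⇒≤ (½^-pos n)

  factor : ∀ h a s b → 2ℚ * (h * a) - h + s * (h * b) ≡ h * (2ℚ * a - 1ℚ + s * b)
  factor = solve 4 (λ h a s b →
    con 2ℚ :* (h :* a) :- h :+ s :* (h :* b) := h :* (con 2ℚ :* a :- con 1ℚ :+ s :* b)) refl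

  Π-½ : ∀ {n} (x : Cube n) → Π (λ _ → ½) x ≡ ½ ^ n
  Π-½ []      = refl
  Π-½ (_ ∷ x) = cong (½ *_) (Π-½ x)

  Π-minority : ∀ m v {n} (x : Cube n) →
    Π (λ s → ½ * (if is m s then 1ℚ else v)) x ≡ ½ ^ n * v ^ count (opposite m) x
  Π-minority m v []      = refl
  Π-minority m v {suc n} (s ∷ x) = trans (cong ((½ * (if is m s then 1ℚ else v)) *_) (Π-minority m v x)) (step m s)
    where
    p = ½ ^ n
    step : ∀ m s → (½ * (if is m s then 1ℚ else v)) * (p * v ^ count (opposite m) x)
         ≡ (½ * p) * v ^ count (opposite m) (s ∷ x)
    keep : ∀ w → (½ * 1ℚ) * (p * w) ≡ (½ * p) * w
    keep = solve 2 (λ p w → (con ½ :* con 1ℚ) :* (p :* w) := (con ½ :* p) :* w) refl p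
    lose : ∀ w → (½ * v) * (p * w) ≡ (½ * p) * (v * w)
    lose = solve 3 (λ v p w → (con ½ :* v) :* (p :* w) := (con ½ :* p) :* (v :* w)) refl v p
    step Sign.+ Sign.+ = keep _
    step Sign.+ Sign.- = lose _
    step Sign.- Sign.+ = lose _
    step Sign.- Sign.- = keep _

  Π-all : ∀ v {n} (x : Cube n) → Π (λ _ → ½ * v) x ≡ ½ ^ n * v ^ n
  Π-all v []      = refl
  Π-all v {suc n} (_ ∷ x) = trans (cong ((½ * v) *_) (Π-all v x))
    (solve 3 (λ v p w → (con ½ :* v) :* (p :* w) := (con ½ :* p) :* (v :* w)) refl v (½ ^ n) (v ^ n))

  -- The erasure channel

  -- The binary erasure channel with reveal probability q, as a joint law: the factor ½ of the
  -- uniform input is included.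
  bec : ℚ → Sign → Erased → ℚ
  bec q _      nothing       = ½ * (1ℚ - q)
  bec q Sign.+ (just Sign.+) = ½ * q
  bec q Sign.- (just Sign.-) = ½ * q
  bec q Sign.+ (just Sign.-) = 0ℚ
  bec q Sign.- (just Sign.+) = 0ℚ

  bec-act : ∀ q t s e → bec q (t Sign.* s) (actᵉ t e) ≡ bec q s e
  bec-act q Sign.+ s      nothing       = refl
  bec-act q Sign.- s      nothing       = refl
  bec-act q Sign.+ s      (just e)      = refl
  bec-act q Sign.- Sign.+ (just Sign.+) = refl
  bec-act q Sign.- Sign.+ (just Sign.-) = refl
  bec-act q Sign.- Sign.- (just Sign.+) = refl
  bec-act q Sign.- Sign.- (just Sign.-) = refl

  erased : List Erased
  erased = nothing ∷ List.map just signs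

  stars : ∀ {n} → Vec Erased n → Bool
  stars []             = true
  stars (nothing ∷ y)  = stars y
  stars (just _ ∷ y)   = false

  only : Sign → ∀ {n} → Vec Erased n → Bool
  only m []            = true
  only m (nothing ∷ y) = only m y
  only m (just s ∷ y)  = is m s ∧ only m y

  one : Sign → ∀ {n} → Vec Erased n → Bool
  one m []            = false
  one m (nothing ∷ y) = one m y
  one m (just s ∷ y)  = is m s ∧ stars y

  stars≡only∧only : ∀ {n} (y : Vec Erased n) → stars y ≡ only Sign.+ y ∧ only Sign.- y
  stars≡only∧only []                = refl
  stars≡only∧only (nothing ∷ y)     = stars≡only∧only y
  stars≡only∧only (just Sign.+ ∷ y) = sym (Bool.∧-zeroʳ _)
  stars≡only∧only (just Sign.- ∷ y) = refl

  single : Sign → ∀ {n} → Fin n → Vec Erased n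
  single s zero    = just s ∷ replicate _ nothing
  single s (suc i) = nothing ∷ single s i

  stars-replicate : ∀ n → stars (replicate n nothing) ≡ true
  stars-replicate zero    = refl
  stars-replicate (suc n) = stars-replicate n

  stars⇒replicate : ∀ {n} (y : Vec Erased n) → stars y ≡ true → y ≡ replicate n nothing
  stars⇒replicate []            _ = refl
  stars⇒replicate (nothing ∷ y) e = cong (nothing ∷_) (stars⇒replicate y e)

  stars-single : ∀ s {n} (i : Fin n) → stars (single s i) ≡ false
  stars-single s zero    = refl
  stars-single s (suc i) = stars-single s i

  one-single : ∀ m s {n} (i : Fin n) → one m (single s i) ≡ is m s
  one-single m s {suc n} zero = trans (cong (is m s ∧_) (stars-replicate n)) (Bool.∧-identityʳ _)
  one-single m s (suc i)      = one-single m s i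

  actᵉ-replicate : ∀ {n} (a : Cube n) → zipWith actᵉ a (replicate n nothing) ≡ replicate n nothing
  actᵉ-replicate []      = refl
  actᵉ-replicate (_ ∷ a) = cong (nothing ∷_) (actᵉ-replicate a)

  actᵉ-single : ∀ {n} (a : Cube n) s i → zipWith actᵉ a (single s i) ≡ single (Vec.lookup a i Sign.* s) i
  actᵉ-single (t ∷ a) s zero    = cong (just (t Sign.* s) ∷_) (actᵉ-replicate a)
  actᵉ-single (t ∷ a) s (suc i) = cong (nothing ∷_) (actᵉ-single a s i)

  data Weight {n} (y : Vec Erased n) : Set where
    none : stars y ≡ true → (∀ m → one m y ≡ false) → Weight y
    unit : ∀ s i → y ≡ single s i → Weight y
    many : stars y ≡ false → (∀ m → one m y ≡ false) → Weight y

  weight : ∀ {n} (y : Vec Erased n) → Weight y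
  weight []            = none refl (λ _ → refl)
  weight (nothing ∷ y) with weight y
  ... | none p q    = none p q
  ... | unit s i eq = unit s (suc i) (cong (nothing ∷_) eq)
  ... | many p q    = many p q
  weight (just s ∷ y) with stars y in eq
  ... | true  = unit s zero (cong (just s ∷_) (stars⇒replicate y eq))
  ... | false = many refl (λ m → trans (cong (is m s ∧_) eq) (Bool.∧-zeroʳ _))

  -- The gain of M per unit of disagreement, written through indicators so that its average is
  -- linear in probabilities: 1 if `b`, -1 otherwise, and the term in `c` resets it to 0 when y
  -- carries no information. There `b` holds for the pure weights (s = -1) and fails for the single
  -- ones (s = 1), whence the two values of `s`.
  κ-value : ℚ → Bool → Bool → ℚ
  κ-value s b c = 2ℚ * 𝟙 b - 1ℚ + s * 𝟙 c

  κ-pure κ-single : ∀ {n} → Sign → Vec Erased n → ℚ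
  κ-pure   m y = κ-value (- 1ℚ) (only m y) (stars y)
  κ-single m y = κ-value 1ℚ (one m y) (stars y)

  -- This is Pr[Y = y] E[f | Y = y]. Working with it avoids division, and its absolute values sum
  -- directly to the functional Φ.
  mean : ℚ → ∀ {n} → (Cube n → Sign) → Vec Erased n → ℚ
  mean q {n} f y = ∑ (cube n) (λ x → ⨂ (bec q) x y * ⟦ f x ⟧)

  ∑∣mean∣ : ℚ → ∀ {n} → (Cube n → Sign) → ℚ
  ∑∣mean∣ q {n} f = ∑ (erasedCube n) (λ y → ∣ mean q f y ∣)

  module Erasure {q : ℚ} (0≤q : 0ℚ ≤ q) (q≤1 : q ≤ 1ℚ) where
    open Powers 0≤q q≤1

    W : ∀ {n} → Cube n → Vec Erased n → ℚ
    W = ⨂ (bec q)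

    W-nonneg : ∀ {n} (x : Cube n) y → 0ℚ ≤ W x y
    W-nonneg = ⨂-nonneg 0≤bec
      where
      0≤½ = ℚ.nonNegative⁻¹ ½
      0≤bec : ∀ s e → 0ℚ ≤ bec q s e
      0≤bec s      nothing       = *-nonneg 0≤½ 0≤v
      0≤bec Sign.+ (just Sign.+) = *-nonneg 0≤½ 0≤q
      0≤bec Sign.- (just Sign.-) = *-nonneg 0≤½ 0≤q
      0≤bec Sign.+ (just Sign.-) = ℚ.≤-refl
      0≤bec Sign.- (just Sign.+) = ℚ.≤-refl

    ∑-W : ∀ {n} (x : Cube n) → ∑ (erasedCube n) (W x) ≡ ½ ^ n
    ∑-W x = trans (∑-multiplicative erased W (bec q) (λ _ → ½) refl (λ _ _ _ _ → refl) row x) (Π-½ x)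
      where
      row : ∀ s → ∑ erased (bec q s) ≡ ½
      row Sign.+ = solve 1 (λ q → con ½ :* (con 1ℚ :- q) :+ (con ½ :* q :+ (con 0ℚ :+ con 0ℚ)) := con ½) refl q
      row Sign.- = solve 1 (λ q → con ½ :* (con 1ℚ :- q) :+ (con 0ℚ :+ (con ½ :* q :+ con 0ℚ)) := con ½) refl q

    only₁ : Sign → Erased → Bool
    only₁ m nothing  = true
    only₁ m (just s) = is m s

    -- A revealed coordinate shows its true value, so the event is that every coordinate of x other
    -- than m is erased.
    ∑-W-only : ∀ m {n} (x : Cube n) →
               ∑ (erasedCube n) (λ y → W x y * 𝟙 (only m y)) ≡ ½ ^ n * v ^ count (opposite m) x
    ∑-W-only m x = trans
      (∑-multiplicative erased (λ x y → W x y * 𝟙 (only m y)) (λ s e → bec q s e * 𝟙 (only₁ m e)) _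
        refl step (row m) x)
      (Π-minority m v x)
      where
      step : ∀ {n} s e (x : Cube n) y →
             W (s ∷ x) (e ∷ y) * 𝟙 (only m (e ∷ y)) ≡ (bec q s e * 𝟙 (only₁ m e)) * (W x y * 𝟙 (only m y))
      step s nothing  x y = 𝟙-∧ (bec q s nothing) (W x y) true (only m y)
      step s (just t) x y = 𝟙-∧ (bec q s (just t)) (W x y) (is m t) (only m y)
      row : ∀ m s → ∑ erased (λ e → bec q s e * 𝟙 (only₁ m e)) ≡ ½ * (if is m s then 1ℚ else v)
      row Sign.+ Sign.+ = solve 1 (λ q → con ½ :* (con 1ℚ :- q) :* con 1ℚ :+ (con ½ :* q :* con 1ℚ :+ (con 0ℚ :+ con 0ℚ)) := con ½ :* con 1ℚ) refl q
      row Sign.+ Sign.- = solve 1 (λ q → con ½ :* (con 1ℚ :- q) :* con 1ℚ :+ (con 0ℚ :+ (con ½ :* q :* con 0ℚ :+ con 0ℚ)) := con ½ :* (con 1ℚ :- q)) refl q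
      row Sign.- Sign.+ = solve 1 (λ q → con ½ :* (con 1ℚ :- q) :* con 1ℚ :+ (con ½ :* q :* con 0ℚ :+ (con 0ℚ :+ con 0ℚ)) := con ½ :* (con 1ℚ :- q)) refl q
      row Sign.- Sign.- = solve 1 (λ q → con ½ :* (con 1ℚ :- q) :* con 1ℚ :+ (con 0ℚ :+ (con ½ :* q :* con 1ℚ :+ con 0ℚ)) := con ½ :* con 1ℚ) refl q

    ∑-W-stars : ∀ {n} (x : Cube n) → ∑ (erasedCube n) (λ y → W x y * 𝟙 (stars y)) ≡ ½ ^ n * v ^ n
    ∑-W-stars x = trans
      (∑-multiplicative erased (λ x y → W x y * 𝟙 (stars y)) (λ s e → bec q s e * 𝟙 (Maybe.is-nothing e)) (λ _ → ½ * v)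
        refl step row x)
      (Π-all v x)
      where
      step : ∀ {n} s e (x : Cube n) y →
             W (s ∷ x) (e ∷ y) * 𝟙 (stars (e ∷ y)) ≡ (bec q s e * 𝟙 (Maybe.is-nothing e)) * (W x y * 𝟙 (stars y))
      step s nothing  x y = 𝟙-∧ (bec q s nothing) (W x y) true (stars y)
      step s (just t) x y = 𝟙-∧ (bec q s (just t)) (W x y) false (stars y)
      row : ∀ s → ∑ erased (λ e → bec q s e * 𝟙 (Maybe.is-nothing e)) ≡ ½ * v
      row s = solve 3 (λ a b c → a :* con 1ℚ :+ (b :* con 0ℚ :+ (c :* con 0ℚ :+ con 0ℚ)) := a) refl
        (½ * v) (bec q s (just Sign.+)) (bec q s (just Sign.-))

    -- "Exactly one revealed" is not a product event, so `∑-multiplicative` does not apply. Either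
    -- the first coordinate is erased and the revealed one comes later, or it is revealed and all
    -- others are erased.
    ∑-W-one-∷ : ∀ m {n} s (x : Cube n) →
      ∑ (erasedCube (suc n)) (λ y → W (s ∷ x) y * 𝟙 (one m y)) ≡
      (½ * v) * ∑ (erasedCube n) (λ y → W x y * 𝟙 (one m y)) + (½ * q) * 𝟙 (is m s) * (½ ^ n * v ^ n)
    ∑-W-one-∷ m {n} s x = trans (∑-vectors erased n (λ y → W (s ∷ x) y * 𝟙 (one m y)))
      (trans (cong₂ _+_ star (cong₂ _+_ (seen Sign.+) (cong (_+ 0ℚ) (seen Sign.-)))) (combine m s))
      where
      ys = erasedCube n
      S = ∑ ys (λ y → W x y * 𝟙 (one m y))
      H = ½ ^ n * v ^ n
      star : ∑ ys (λ y → (½ * v * W x y) * 𝟙 (one m y)) ≡ ½ * v * S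
      star = trans (∑-cong ys (λ y → ℚ.*-assoc (½ * v) (W x y) _)) (∑-* ys (½ * v) _)
      seen : ∀ t → ∑ ys (λ y → (bec q s (just t) * W x y) * 𝟙 (is m t ∧ stars y)) ≡ bec q s (just t) * 𝟙 (is m t) * H
      seen t = trans (∑-cong ys (λ y → 𝟙-∧ (bec q s (just t)) (W x y) (is m t) (stars y)))
        (trans (∑-* ys (bec q s (just t) * 𝟙 (is m t)) (λ y → W x y * 𝟙 (stars y)))
          (cong (bec q s (just t) * 𝟙 (is m t) *_) (∑-W-stars x)))
      combine : ∀ m s →
        ½ * v * S + (bec q s (just Sign.+) * 𝟙 (is m Sign.+) * H + (bec q s (just Sign.-) * 𝟙 (is m Sign.-) * H + 0ℚ))
        ≡ ½ * v * S + ½ * q * 𝟙 (is m s) * H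
      combine Sign.+ Sign.+ = solve 3 (λ a q H → a :+ (con ½ :* q :* con 1ℚ :* H :+ (con 0ℚ :* H :+ con 0ℚ)) := a :+ con ½ :* q :* con 1ℚ :* H) refl (½ * v * S) q H
      combine Sign.+ Sign.- = solve 3 (λ a q H → a :+ (con 0ℚ :* H :+ (con ½ :* q :* con 0ℚ :* H :+ con 0ℚ)) := a :+ con ½ :* q :* con 0ℚ :* H) refl (½ * v * S) q H
      combine Sign.- Sign.+ = solve 3 (λ a q H → a :+ (con ½ :* q :* con 0ℚ :* H :+ (con 0ℚ :* H :+ con 0ℚ)) := a :+ con ½ :* q :* con 0ℚ :* H) refl (½ * v * S) q H
      combine Sign.- Sign.- = solve 3 (λ a q H → a :+ (con 0ℚ :* H :+ (con ½ :* q :* con 1ℚ :* H :+ con 0ℚ)) := a :+ con ½ :* q :* con 1ℚ :* H) refl (½ * v * S) q H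

    ∑-W-one : ∀ m {n} (x : Cube (suc n)) →
      ∑ (erasedCube (suc n)) (λ y → W x y * 𝟙 (one m y)) ≡ ½ ^ suc n * (ι (count m x) * (q * v ^ n))
    -- The induction starts at length one because the exponent of `v` counts the other coordinates.
    ∑-W-one m {zero} (s ∷ []) = trans (∑-W-one-∷ m s []) (base (is m s))
      where
      base : ∀ b → (½ * v) * (1ℚ * 0ℚ + 0ℚ) + (½ * q) * 𝟙 b * (1ℚ * 1ℚ)
           ≡ (½ * 1ℚ) * (ι (if b then 1 else 0) * (q * 1ℚ))
      base true  = solve 1 (λ q → (con ½ :* (con 1ℚ :- q)) :* con 0ℚ :+ (con ½ :* q) :* con 1ℚ :* con 1ℚ := con ½ :* (con 1ℚ :* (q :* con 1ℚ))) refl q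
      base false = solve 1 (λ q → (con ½ :* (con 1ℚ :- q)) :* con 0ℚ :+ (con ½ :* q) :* con 0ℚ :* con 1ℚ := con ½ :* (con 0ℚ :* (q :* con 1ℚ))) refl q
    ∑-W-one m {suc n} (s ∷ x) = trans (∑-W-one-∷ m s x)
      (trans (cong (λ S → (½ * v) * S + (½ * q) * 𝟙 (is m s) * (½ ^ suc n * v ^ suc n)) (∑-W-one m x))
        (step (is m s)))
      where
      p = ½ ^ suc n
      w = v ^ n
      step : ∀ b → (½ * v) * (p * (ι (count m x) * (q * w))) + (½ * q) * 𝟙 b * (p * (v * w))
           ≡ (½ * p) * (ι (if b then suc (count m x) else count m x) * (q * (v * w)))
      step true  = solve 5 (λ v q p w c → (con ½ :* v) :* (p :* (c :* (q :* w))) :+ (con ½ :* q) :* con 1ℚ :* (p :* (v :* w))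
        := (con ½ :* p) :* ((con 1ℚ :+ c) :* (q :* (v :* w)))) refl v q p w (ι (count m x))
      step false = solve 5 (λ v q p w c → (con ½ :* v) :* (p :* (c :* (q :* w))) :+ (con ½ :* q) :* con 0ℚ :* (p :* (v :* w))
        := (con ½ :* p) :* (c :* (q :* (v :* w)))) refl v q p w (ι (count m x))

    -- Comparing the means of two functions given y

    A : ∀ {n} → (Cube n → Sign) → Vec Erased n → ℚ
    A = mean q

    Φ : ∀ {n} → (Cube n → Sign) → ℚ
    Φ = ∑∣mean∣ q

    A-flip : ∀ {n} (a : Cube n) (f : Cube n → Sign) y → A (f ∘ flip a) y ≡ A f (zipWith actᵉ a y)
    A-flip {n} a f y = trans
      (∑-cong (cube n) (λ x → cong (_* ⟦ f (flip a x) ⟧) (sym (⨂-flipᵉ (bec-act q) a x y))))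
      (∑-flip a (λ x → W x (zipWith actᵉ a y) * ⟦ f x ⟧))

    Φ-flip : ∀ {n} (a : Cube n) (f : Cube n → Sign) → Φ (f ∘ flip a) ≡ Φ f
    Φ-flip {n} a f = trans (∑-cong (erasedCube n) (λ y → cong ∣_∣ (A-flip a f y))) (∑-flipᵉ a (λ y → ∣ A f y ∣))

    A-∷ : ∀ {n} (f : Cube (suc n) → Sign) e y →
          A f (e ∷ y) ≡ bec q Sign.+ e * A (f ∘ (Sign.+ ∷_)) y + bec q Sign.- e * A (f ∘ (Sign.- ∷_)) y
    A-∷ {n} f e y = trans (∑-cube n (λ x → W x (e ∷ y) * ⟦ f x ⟧)) (cong₂ _+_ (half Sign.+) (half Sign.-))
      where
      half : ∀ s → ∑ (cube n) (λ x → (bec q s e * W x y) * ⟦ f (s ∷ x) ⟧) ≡ bec q s e * A (f ∘ (s ∷_)) y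
      half s = trans (∑-cong (cube n) (λ x → ℚ.*-assoc (bec q s e) (W x y) _)) (∑-* (cube n) (bec q s e) _)

    -- κ m y weighs, at y, a point where f differs from M and M takes the value m.
    data Kind {n} (f : Cube n → Sign) (κ : Sign → Vec Erased n → ℚ) (y : Vec Erased n) : Set where
      null    : (∀ m → κ m y ≡ 0ℚ) → A f y ≡ 0ℚ → Kind f κ y
      aligned : ∀ σ → (∀ m → κ m y ≡ ⟦ σ ⟧ * ⟦ m ⟧) → 0ℚ ≤ ⟦ σ ⟧ * A f y → Kind f κ y
      other   : (∀ m → κ m y ≡ - 1ℚ) → Kind f κ y

    module _ {n} (f M : Cube n → Sign) (κ : Sign → Vec Erased n → ℚ) (kind : ∀ y → Kind f κ y) where
      private
        xs = cube n
        ys = erasedCube n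
        D : Cube n → ℚ
        D x = Δ (f x) (M x)

      -- In the aligned case `Δ*⟦⟧` makes the sum equal to σ(`A M y` - `A f y`), so the left side
      -- collapses to σ `A M y`. In the last case the sum is minus the total disagreement, and the
      -- claim is the triangle inequality.
      ∣A∣-gap : ∀ y → ∣ A f y ∣ + ∑ xs (λ x → W x y * (D x * κ (M x) y)) ≤ ∣ A M y ∣
      ∣A∣-gap y with kind y
      ... | null κ≡0 Af≡0 = subst (_≤ ∣ A M y ∣)
        (sym (cong₂ _+_ (cong ∣_∣ Af≡0) (trans (∑-cong xs vanish) (∑-zero xs)))) 0≤∣ A M y ∣
        where
        vanish : ∀ x → W x y * (D x * κ (M x) y) ≡ 0ℚ
        vanish x = trans (cong (λ t → W x y * (D x * t)) (κ≡0 (M x)))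
          (solve 2 (λ w d → w :* (d :* con 0ℚ) := con 0ℚ) refl (W x y) (D x))
      ... | aligned σ κ≡ 0≤σA = subst (_≤ ∣ A M y ∣) (sym (begin
        ∣ A f y ∣ + ∑ xs (λ x → W x y * (D x * κ (M x) y))
          ≡⟨ cong₂ _+_ (signed-abs σ 0≤σA) (trans (∑-cong xs term) (∑-* xs ⟦ σ ⟧ _)) ⟩
        ⟦ σ ⟧ * A f y + ⟦ σ ⟧ * ∑ xs (λ x → W x y * ⟦ M x ⟧ - W x y * ⟦ f x ⟧)
          ≡⟨ cong (λ t → ⟦ σ ⟧ * A f y + ⟦ σ ⟧ * t) (∑-- xs (λ x → W x y * ⟦ M x ⟧) (λ x → W x y * ⟦ f x ⟧)) ⟩
        ⟦ σ ⟧ * A f y + ⟦ σ ⟧ * (A M y - A f y)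
          ≡⟨ solve 3 (λ s a b → s :* a :+ s :* (b :- a) := s :* b) refl ⟦ σ ⟧ (A f y) (A M y) ⟩
        ⟦ σ ⟧ * A M y ∎)) (signed≤abs σ (A M y))
        where
        open ≡-Reasoning
        term : ∀ x → W x y * (D x * κ (M x) y) ≡ ⟦ σ ⟧ * (W x y * ⟦ M x ⟧ - W x y * ⟦ f x ⟧)
        term x = begin
          W x y * (D x * κ (M x) y)                        ≡⟨ cong (λ t → W x y * (D x * t)) (κ≡ (M x)) ⟩
          W x y * (D x * (⟦ σ ⟧ * ⟦ M x ⟧))
            ≡⟨ solve 4 (λ w d s m → w :* (d :* (s :* m)) := s :* (w :* (d :* m))) refl (W x y) (D x) ⟦ σ ⟧ ⟦ M x ⟧ ⟩
          ⟦ σ ⟧ * (W x y * (D x * ⟦ M x ⟧))                 ≡⟨ cong (λ t → ⟦ σ ⟧ * (W x y * t)) (Δ*⟦⟧ (f x) (M x)) ⟩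
          ⟦ σ ⟧ * (W x y * (⟦ M x ⟧ - ⟦ f x ⟧))
            ≡⟨ solve 4 (λ s w m f → s :* (w :* (m :- f)) := s :* (w :* m :- w :* f)) refl ⟦ σ ⟧ (W x y) ⟦ M x ⟧ ⟦ f x ⟧ ⟩
          ⟦ σ ⟧ * (W x y * ⟦ M x ⟧ - W x y * ⟦ f x ⟧)        ∎
      ... | other κ≡-1 = subst₂ _≤_ (cong (∣ A f y ∣ +_) (sym (trans (∑-cong xs term) (∑-neg xs (λ x → W x y * D x)))))
          (solve 2 (λ a d → (a :+ d) :- d := a) refl ∣ A M y ∣ (∑ xs (λ x → W x y * D x)))
          (ℚ.+-monoˡ-≤ (- ∑ xs (λ x → W x y * D x)) triangle)
        where
        term : ∀ x → W x y * (D x * κ (M x) y) ≡ - (W x y * D x)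
        term x = trans (cong (λ t → W x y * (D x * t)) (κ≡-1 (M x)))
          (solve 2 (λ w d → w :* (d :* con (- 1ℚ)) := :- (w :* d)) refl (W x y) (D x))
        difference : ∀ x → ∣ W x y * ⟦ f x ⟧ - W x y * ⟦ M x ⟧ ∣ ≡ W x y * D x
        difference x = trans
          (cong ∣_∣ (solve 3 (λ w f m → w :* f :- w :* m := w :* (f :- m)) refl (W x y) ⟦ f x ⟧ ⟦ M x ⟧))
          (trans (ℚ.∣p*q∣≡∣p∣*∣q∣ (W x y) (⟦ f x ⟧ - ⟦ M x ⟧)) (cong (_* D x) (ℚ.0≤p⇒∣p∣≡p (W-nonneg x y))))
        triangle : ∣ A f y ∣ ≤ ∣ A M y ∣ + ∑ xs (λ x → W x y * D x)
        triangle = begin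
          ∣ A f y ∣                               ≡⟨ cong ∣_∣ (solve 2 (λ a b → a := b :+ (a :- b)) refl (A f y) (A M y)) ⟩
          ∣ A M y + (A f y - A M y) ∣             ≤⟨ ℚ.∣p+q∣≤∣p∣+∣q∣ (A M y) (A f y - A M y) ⟩
          ∣ A M y ∣ + ∣ A f y - A M y ∣           ≡⟨ cong (λ t → ∣ A M y ∣ + ∣ t ∣) (∑-- xs (λ x → W x y * ⟦ f x ⟧) (λ x → W x y * ⟦ M x ⟧)) ⟨
          ∣ A M y ∣ + ∣ ∑ xs (λ x → W x y * ⟦ f x ⟧ - W x y * ⟦ M x ⟧) ∣
            ≤⟨ ℚ.+-monoʳ-≤ ∣ A M y ∣ (∣∑∣≤∑∣∣ xs (λ x → W x y * ⟦ f x ⟧ - W x y * ⟦ M x ⟧)) ⟩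
          ∣ A M y ∣ + ∑ xs (λ x → ∣ W x y * ⟦ f x ⟧ - W x y * ⟦ M x ⟧ ∣)
            ≡⟨ cong (∣ A M y ∣ +_) (∑-cong xs difference) ⟩
          ∣ A M y ∣ + ∑ xs (λ x → W x y * D x)    ∎
          where open ℚ.≤-Reasoning

      -- After summing over y and exchanging the sums, each x contributes its disagreement times the
      -- average of κ over the outputs of x, and `c` bounds that average below for all x at once.
      Φ-gap : ∀ {c} → (∀ x → c ≤ ∑ ys (λ y → W x y * κ (M x) y)) → Φ f + c * distance f M ≤ Φ M
      Φ-gap {c} bound = begin
        Φ f + c * distance f M                                            ≡⟨ cong (Φ f +_) (∑-* xs c D) ⟨
        Φ f + ∑ xs (λ x → c * D x)                                        ≤⟨ ℚ.+-monoʳ-≤ (Φ f) (∑-mono xs weigh) ⟩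
        Φ f + ∑ xs (λ x → ∑ ys (λ y → W x y * (D x * κ (M x) y)))
          ≡⟨ cong (Φ f +_) (∑-swap xs ys (λ x y → W x y * (D x * κ (M x) y))) ⟩
        Φ f + ∑ ys (λ y → ∑ xs (λ x → W x y * (D x * κ (M x) y)))         ≡⟨ ∑-+ ys (λ y → ∣ A f y ∣) (λ y → ∑ xs (λ x → W x y * (D x * κ (M x) y))) ⟨
        ∑ ys (λ y → ∣ A f y ∣ + ∑ xs (λ x → W x y * (D x * κ (M x) y)))   ≤⟨ ∑-mono ys ∣A∣-gap ⟩
        Φ M                                                               ∎
        where
        open ℚ.≤-Reasoning
        weigh : ∀ x → c * D x ≤ ∑ ys (λ y → W x y * (D x * κ (M x) y))
        weigh x = begin
          c * D x                                       ≡⟨ ℚ.*-comm c (D x) ⟩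
          D x * c                                       ≤⟨ *-monoˡ 0≤∣ ⟦ f x ⟧ - ⟦ M x ⟧ ∣ (bound x) ⟩
          D x * ∑ ys (λ y → W x y * κ (M x) y)          ≡⟨ ∑-* ys (D x) _ ⟨
          ∑ ys (λ y → D x * (W x y * κ (M x) y))
            ≡⟨ ∑-cong ys (λ y → solve 3 (λ d w k → d :* (w :* k) := w :* (d :* k)) refl (D x) (W x y) (κ (M x) y)) ⟩
          ∑ ys (λ y → W x y * (D x * κ (M x) y))        ∎

    -- `share y * total f` is the value that `A f y` would have if f had the same mean on the face
    -- of inputs compatible with y as on the whole cube. Each revealed coordinate halves that face,
    -- hence the second ½.
    share : ∀ {n} → Vec Erased n → ℚ
    share []            = 1ℚ
    share (nothing ∷ y) = (½ * v) * share y
    share (just _ ∷ y)  = (½ * q) * (½ * share y)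

    share-nonneg : ∀ {n} (y : Vec Erased n) → 0ℚ ≤ share y
    share-nonneg []            = ℚ.nonNegative⁻¹ 1ℚ
    share-nonneg (nothing ∷ y) = *-nonneg (*-nonneg (ℚ.nonNegative⁻¹ ½) 0≤v) (share-nonneg y)
    share-nonneg (just _ ∷ y)  = *-nonneg (*-nonneg (ℚ.nonNegative⁻¹ ½) 0≤q) (*-nonneg (ℚ.nonNegative⁻¹ ½) (share-nonneg y))

    A-stars : ∀ {n} (f : Cube n → Sign) y → stars y ≡ true → A f y ≡ share y * total f
    A-stars f []            _ = solve 1 (λ a → con 1ℚ :* a :+ con 0ℚ := con 1ℚ :* (a :+ con 0ℚ)) refl ⟦ f [] ⟧
    A-stars {suc n} f (nothing ∷ y) e = begin
      A f (nothing ∷ y)                                     ≡⟨ A-∷ f nothing y ⟩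
      (½ * v) * A f₊ y + (½ * v) * A f₋ y
        ≡⟨ cong₂ (λ a b → (½ * v) * a + (½ * v) * b) (A-stars f₊ y e) (A-stars f₋ y e) ⟩
      (½ * v) * (share y * total f₊) + (½ * v) * (share y * total f₋)
        ≡⟨ solve 4 (λ v p a b → v :* (p :* a) :+ v :* (p :* b) := (v :* p) :* (a :+ b)) refl (½ * v) (share y) (total f₊) (total f₋) ⟩
      ((½ * v) * share y) * (total f₊ + total f₋)           ≡⟨ cong (((½ * v) * share y) *_) (∑-cube n (⟦_⟧ ∘ f)) ⟨
      ((½ * v) * share y) * total f                         ∎
      where
      open ≡-Reasoning
      f₊ f₋ : Cube n → Sign
      f₊ = f ∘ (Sign.+ ∷_)
      f₋ = f ∘ (Sign.- ∷_)

    -- Restricting a monotone f to a face where only σ is revealed can only push its mean towards σ.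
    pure-mean : ∀ σ {n} {f : Cube n → Sign} → Monotone f → ∀ y → only σ y ≡ true →
                share y * (⟦ σ ⟧ * total f) ≤ ⟦ σ ⟧ * A f y
    pure-mean σ {f = f} mono [] _ = ℚ.≤-reflexive
      (solve 2 (λ s a → con 1ℚ :* (s :* (a :+ con 0ℚ)) := s :* (con 1ℚ :* a :+ con 0ℚ)) refl ⟦ σ ⟧ ⟦ f [] ⟧)
    pure-mean σ {suc n} {f} mono (e ∷ y) eq = subst₂ (λ T B → share (e ∷ y) * (⟦ σ ⟧ * T) ≤ ⟦ σ ⟧ * B)
      (sym (∑-cube n (⟦_⟧ ∘ f))) (sym (A-∷ f e y)) (step σ e eq)
      where
      f₊ f₋ : Cube n → Sign
      f₊ = f ∘ (Sign.+ ∷_)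
      f₋ = f ∘ (Sign.- ∷_)
      p = share y
      T₊ = total f₊
      T₋ = total f₋
      T₋≤T₊ : T₋ ≤ T₊
      T₋≤T₊ = ∑-mono (cube n) (λ x → ⟦⟧-mono (mono (ℤ.-≤+ ∷ ⊑-refl x)))
      ih : ∀ σ s → only σ y ≡ true → 0ℚ ≤ ⟦ σ ⟧ * A (f ∘ (s ∷_)) y - p * (⟦ σ ⟧ * total (f ∘ (s ∷_)))
      ih σ s eq = ≤⇒0≤- (pure-mean σ (Monotone-∷ mono s) y eq)
      step : ∀ σ e → only σ (e ∷ y) ≡ true → share (e ∷ y) * (⟦ σ ⟧ * (T₊ + T₋))
           ≤ ⟦ σ ⟧ * (bec q Sign.+ e * A f₊ y + bec q Sign.- e * A f₋ y)
      step σ nothing eq = ≤-by (½ * v * (⟦ σ ⟧ * A f₊ y - p * (⟦ σ ⟧ * T₊) + (⟦ σ ⟧ * A f₋ y - p * (⟦ σ ⟧ * T₋))))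
        (*-nonneg (*-nonneg (ℚ.nonNegative⁻¹ ½) 0≤v) (+-nonneg (ih σ Sign.+ eq) (ih σ Sign.- eq)))
        (solve 7 (λ v p s T U A B → s :* (v :* A :+ v :* B)
          := v :* p :* (s :* (T :+ U)) :+ v :* (s :* A :- p :* (s :* T) :+ (s :* B :- p :* (s :* U))))
          refl (½ * v) p ⟦ σ ⟧ T₊ T₋ (A f₊ y) (A f₋ y))
      -- The revealed half has total T₊ instead of the average ½ (T₊ + T₋); the excess ½ (T₊ - T₋)
      -- is nonnegative by monotonicity. The clause for - is symmetric.
      step Sign.+ (just Sign.+) eq = ≤-by
        (½ * q * (⟦ Sign.+ ⟧ * A f₊ y - p * (⟦ Sign.+ ⟧ * T₊) + ½ * p * (T₊ - T₋)))
        (*-nonneg (*-nonneg (ℚ.nonNegative⁻¹ ½) 0≤q) (+-nonneg (ih Sign.+ Sign.+ eq)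
          (*-nonneg (*-nonneg (ℚ.nonNegative⁻¹ ½) (share-nonneg y)) (≤⇒0≤- T₋≤T₊))))
        (solve 6 (λ q p T U A B → con 1ℚ :* (q :* A :+ con 0ℚ :* B)
          := q :* (con ½ :* p) :* (con 1ℚ :* (T :+ U))
             :+ q :* (con 1ℚ :* A :- p :* (con 1ℚ :* T) :+ con ½ :* p :* (T :- U)))
          refl (½ * q) p T₊ T₋ (A f₊ y) (A f₋ y))
      step Sign.- (just Sign.-) eq = ≤-by
        (½ * q * (⟦ Sign.- ⟧ * A f₋ y - p * (⟦ Sign.- ⟧ * T₋) + ½ * p * (T₊ - T₋)))
        (*-nonneg (*-nonneg (ℚ.nonNegative⁻¹ ½) 0≤q) (+-nonneg (ih Sign.- Sign.- eq)
          (*-nonneg (*-nonneg (ℚ.nonNegative⁻¹ ½) (share-nonneg y)) (≤⇒0≤- T₋≤T₊))))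
        (solve 6 (λ q p T U A B → con (- 1ℚ) :* (con 0ℚ :* A :+ q :* B)
          := q :* (con ½ :* p) :* (con (- 1ℚ) :* (T :+ U))
             :+ q :* (con (- 1ℚ) :* B :- p :* (con (- 1ℚ) :* U) :+ con ½ :* p :* (T :- U)))
          refl (½ * q) p T₊ T₋ (A f₊ y) (A f₋ y))

    pure-kind : ∀ {n} {f : Cube n → Sign} → Monotone f → total f ≡ 0ℚ → ∀ y → Kind f κ-pure y
    pure-kind {f = f} mono tf≡0 y = kind _ _ refl refl (stars≡only∧only y)
      where
      vanish : share y * total f ≡ 0ℚ
      vanish = trans (cong (share y *_) tf≡0) (ℚ.*-zeroʳ (share y))
      aligned-mean : ∀ σ → only σ y ≡ true → 0ℚ ≤ ⟦ σ ⟧ * A f y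
      aligned-mean σ eq = subst (_≤ ⟦ σ ⟧ * A f y)
        (trans (cong (λ t → share y * (⟦ σ ⟧ * t)) tf≡0) (solve 2 (λ p s → p :* (s :* con 0ℚ) := con 0ℚ) refl (share y) ⟦ σ ⟧))
        (pure-mean σ mono y eq)
      by-sign : ∀ {c : Sign → ℚ} → κ-pure Sign.+ y ≡ c Sign.+ → κ-pure Sign.- y ≡ c Sign.- → ∀ m → κ-pure m y ≡ c m
      by-sign e₊ e₋ Sign.+ = e₊
      by-sign e₊ e₋ Sign.- = e₋
      kind : ∀ b c → only Sign.+ y ≡ b → only Sign.- y ≡ c → stars y ≡ b ∧ c → Kind f κ-pure y
      -- Both equations are formed before the split on `b` and `c`; afterwards their right-hand
      -- sides compute to 0, 1 or -1.
      kind b c eb ec ed with cong₂ (κ-value (- 1ℚ)) eb ed | cong₂ (κ-value (- 1ℚ)) ec ed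
      kind true  true  eb ec ed | e₊ | e₋ = null (by-sign e₊ e₋) (trans (A-stars f y ed) vanish)
      kind true  false eb ec ed | e₊ | e₋ = aligned Sign.+ (by-sign e₊ e₋) (aligned-mean Sign.+ eb)
      kind false true  eb ec ed | e₊ | e₋ = aligned Sign.- (by-sign e₊ e₋) (aligned-mean Sign.- ec)
      kind false false eb ec ed | e₊ | e₋ = other (by-sign e₊ e₋)

    -- The faces with coordinate i equal to + and to - partition the cube and carry the same channel
    -- weight. The constant is chosen before f because the induction applies it to both halves of f.
    A-single-pair : ∀ {n} (i : Fin n) → ∃ λ c → ∀ f → A f (single Sign.+ i) + A f (single Sign.- i) ≡ c * total f
    A-single-pair {suc n} zero = ½ * q * p , λ f →
      let f₊ = f ∘ (Sign.+ ∷_) ; f₋ = f ∘ (Sign.- ∷_) in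
      trans (cong₂ _+_ (A-∷ f (just Sign.+) ⋆) (A-∷ f (just Sign.-) ⋆))
        (trans (cong₂ (λ a b → (½ * q * a + 0ℚ * b) + (0ℚ * a + ½ * q * b))
            (A-stars f₊ ⋆ (stars-replicate n)) (A-stars f₋ ⋆ (stars-replicate n)))
          (trans (solve 4 (λ q p a b → (q :* (p :* a) :+ con 0ℚ :* (p :* b)) :+ (con 0ℚ :* (p :* a) :+ q :* (p :* b))
              := q :* p :* (a :+ b)) refl (½ * q) p (total f₊) (total f₋))
            (cong (½ * q * p *_) (sym (∑-cube n (⟦_⟧ ∘ f))))))
      where
      ⋆ = replicate n nothing
      p = share ⋆
    A-single-pair {suc n} (suc i) with A-single-pair i
    ... | c , pair = ½ * v * c , λ f →
      let f₊ = f ∘ (Sign.+ ∷_) ; f₋ = f ∘ (Sign.- ∷_) in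
      trans (cong₂ _+_ (A-∷ f nothing (single Sign.+ i)) (A-∷ f nothing (single Sign.- i)))
        (trans (solve 5 (λ v a b a′ b′ → (v :* a :+ v :* b) :+ (v :* a′ :+ v :* b′) := v :* ((a :+ a′) :+ (b :+ b′)))
            refl (½ * v) (A f₊ (single Sign.+ i)) (A f₋ (single Sign.+ i)) (A f₊ (single Sign.- i)) (A f₋ (single Sign.- i)))
          (trans (cong₂ (λ a b → ½ * v * (a + b)) (pair f₊) (pair f₋))
            (trans (solve 4 (λ v c a b → v :* (c :* a :+ c :* b) := v :* c :* (a :+ b)) refl (½ * v) c (total f₊) (total f₋))
              (cong (½ * v * c *_) (sym (∑-cube n (⟦_⟧ ∘ f)))))))

    A-single- : ∀ {n} (f : Cube n → Sign) → total f ≡ 0ℚ → ∀ i → A f (single Sign.- i) ≡ - A f (single Sign.+ i)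
    A-single- f tf≡0 i with A-single-pair i
    ... | c , pair = trans (solve 2 (λ a b → b := (a :+ b) :- a) refl (A f (single Sign.+ i)) (A f (single Sign.- i)))
      (trans (cong (_- A f (single Sign.+ i)) (trans (pair f) (trans (cong (c *_) tf≡0) (ℚ.*-zeroʳ c)))) (ℚ.+-identityˡ _))

    single-kind : ∀ {n} {f : Cube n → Sign} → (∀ i → 0ℚ ≤ A f (single Sign.+ i)) → total f ≡ 0ℚ →
                  ∀ y → Kind f κ-single y
    single-kind {f = f} pos tf≡0 y with weight y
    ... | none st ∅ = null (λ m → cong₂ (κ-value 1ℚ) (∅ m) st)
      (trans (A-stars f y st) (trans (cong (share y *_) tf≡0) (ℚ.*-zeroʳ (share y))))
    ... | many st ∅ = other (λ m → cong₂ (κ-value 1ℚ) (∅ m) st)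
    ... | unit s i refl = aligned s (λ m → trans (cong₂ (κ-value 1ℚ) (one-single m s i) (stars-single s i)) (eval s m)) (sign s)
      where
      eval : ∀ s m → κ-value 1ℚ (is m s) false ≡ ⟦ s ⟧ * ⟦ m ⟧
      eval Sign.+ Sign.+ = refl
      eval Sign.+ Sign.- = refl
      eval Sign.- Sign.+ = refl
      eval Sign.- Sign.- = refl
      sign : ∀ s → 0ℚ ≤ ⟦ s ⟧ * A f (single s i)
      sign Sign.+ = subst (0ℚ ≤_) (sym (ℚ.*-identityˡ _)) (pos i)
      sign Sign.- = subst (0ℚ ≤_)
        (trans (solve 1 (λ a → a := con (- 1ℚ) :* (:- a)) refl (A f (single Sign.+ i)))
          (cong (⟦ Sign.- ⟧ *_) (sym (A-single- f tf≡0 i))))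
        (pos i)

    -- For unbiased f, `A f (single Sign.+ i)` is a nonnegative multiple of the degree-one Fourier
    -- coefficient at i, and by `A-single-` revealing - instead negates it. One of the two signs
    -- therefore works, and a flip of coordinate i exchanges them.
    orientation : ∀ {n} (f : Cube n → Sign) → total f ≡ 0ℚ →
                  ∃ λ a → ∀ i → 0ℚ ≤ A (f ∘ flip a) (single Sign.+ i)
    orientation {n} f tf≡0 = a , λ i → subst (0ℚ ≤_) (sym (begin
        A (f ∘ flip a) (single Sign.+ i)              ≡⟨ A-flip a f (single Sign.+ i) ⟩
        A f (zipWith actᵉ a (single Sign.+ i))        ≡⟨ cong (A f) (actᵉ-single a Sign.+ i) ⟩
        A f (single (Vec.lookup a i Sign.* Sign.+) i)
          ≡⟨ cong (λ s → A f (single s i)) (trans (SignP.*-identityʳ _) (VecP.lookup∘tabulate _ i)) ⟩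
        A f (single (proj₁ (choose i)) i)             ∎)) (proj₂ (choose i))
      where
      open ≡-Reasoning
      choose : ∀ i → ∃ λ s → 0ℚ ≤ A f (single s i)
      choose i with ℚ.≤-total 0ℚ (A f (single Sign.+ i))
      ... | inj₁ 0≤a = Sign.+ , 0≤a
      ... | inj₂ a≤0 = Sign.- , subst (0ℚ ≤_) (sym (A-single- f tf≡0 i)) (ℚ.neg-antimono-≤ a≤0)
      a = Vec.tabulate (λ i → proj₁ (choose i))

    -- The gap of majority under erasure

    module _ (k : ℕ) where
      private
        n : ℕ
        n = suc (k ℕ.+ k)
        h : ℚ
        h = ½ ^ n

      Φ-gap-monotone : ∀ {f : Cube n → Sign} → Monotone f → total f ≡ 0ℚ →
        Φ f + h * (q * (1ℚ - ι k * (ι k + 2ℚ) * q)) * distance f (Maj n) ≤ Φ (Maj n)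
      Φ-gap-monotone {f} mono tf≡0 = Φ-gap f (Maj n) κ-pure (pure-kind mono tf≡0) {h * (q * (1ℚ - ι k * (ι k + 2ℚ) * q))} λ x →
        ℚ.≤-trans (*-monoˡ (½^-nonneg n) (pure-bound k (Maj-minority k x)))
          (ℚ.≤-reflexive (sym (weight-sum (Maj n x) x)))
        where
        weight-sum : ∀ m x → ∑ (erasedCube n) (λ y → W x y * κ-pure m y) ≡ h * (2ℚ * v ^ count (opposite m) x - 1ℚ + - 1ℚ * v ^ n)
        weight-sum m x = trans (∑-κ (erasedCube n) (W x) (λ y → 𝟙 (only m y)) (λ y → 𝟙 (stars y)) (- 1ℚ))
          (trans (cong₂ (λ a b → a + - 1ℚ * b) (cong₂ (λ a b → 2ℚ * a - b) (∑-W-only m x) (∑-W x)) (∑-W-stars x))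
            (factor h (v ^ count (opposite m) x) (- 1ℚ) (v ^ n)))

      Φ-gap-oriented : ∀ {f : Cube n → Sign} → (∀ i → 0ℚ ≤ A f (single Sign.+ i)) → total f ≡ 0ℚ →
        Φ f + h * (q * (1ℚ - ι k * (2ℚ * ι k + (2ℚ + 1ℚ)) * q)) * distance f (Maj n) ≤ Φ (Maj n)
      Φ-gap-oriented {f} pos tf≡0 = Φ-gap f (Maj n) κ-single (single-kind pos tf≡0) {h * (q * (1ℚ - ι k * (2ℚ * ι k + (2ℚ + 1ℚ)) * q))} λ x →
        ℚ.≤-trans (*-monoˡ (½^-nonneg n) (single-bound k (Maj-majority k x)))
          (ℚ.≤-reflexive (sym (weight-sum (Maj n x) x)))
        where
        weight-sum : ∀ m x → ∑ (erasedCube n) (λ y → W x y * κ-single m y) ≡ h * (2ℚ * (ι (count m x) * (q * v ^ (k ℕ.+ k))) - 1ℚ + 1ℚ * v ^ n)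
        weight-sum m x = trans (∑-κ (erasedCube n) (W x) (λ y → 𝟙 (one m y)) (λ y → 𝟙 (stars y)) 1ℚ)
          (trans (cong₂ (λ a b → a + 1ℚ * b) (cong₂ (λ a b → 2ℚ * a - b) (∑-W-one m x) (∑-W x)) (∑-W-stars x))
            (factor h (ι (count m x) * (q * v ^ (k ℕ.+ k))) 1ℚ (v ^ n)))

  -- The symmetric channel

  bsc : ℚ → Sign → Sign → ℚ
  bsc q Sign.+ Sign.+ = ½ * (1ℚ - q)
  bsc q Sign.- Sign.- = ½ * (1ℚ - q)
  bsc q Sign.+ Sign.- = ½ * q
  bsc q Sign.- Sign.+ = ½ * q

  bsc-act : ∀ q t s u → bsc q (t Sign.* s) (t Sign.* u) ≡ bsc q s u
  bsc-act q Sign.+ s      u      = refl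
  bsc-act q Sign.- Sign.+ Sign.+ = refl
  bsc-act q Sign.- Sign.+ Sign.- = refl
  bsc-act q Sign.- Sign.- Sign.+ = refl
  bsc-act q Sign.- Sign.- Sign.- = refl

  bsc-sym : ∀ q s t → bsc q s t ≡ bsc q t s
  bsc-sym q Sign.+ Sign.+ = refl
  bsc-sym q Sign.+ Sign.- = refl
  bsc-sym q Sign.- Sign.+ = refl
  bsc-sym q Sign.- Sign.- = refl

  same : ∀ {n} → Cube n → Cube n → Bool
  same []      []      = true
  same (s ∷ x) (t ∷ y) = is s t ∧ same x y

  leaves₁ : Sign → Sign → Sign → Bool
  leaves₁ m s t = is s t ∨ is m s

  -- Every coordinate in which x and y differ has the value m in x.
  leaves : Sign → ∀ {n} → Cube n → Cube n → Bool
  leaves m []      []      = true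
  leaves m (s ∷ x) (t ∷ y) = leaves₁ m s t ∧ leaves m x y

  leaves-swap : ∀ m {n} (x y : Cube n) → leaves m y x ≡ leaves (opposite m) x y
  leaves-swap m []      []      = refl
  leaves-swap m (s ∷ x) (t ∷ y) = cong₂ _∧_ (swap₁ m s t) (leaves-swap m x y)
    where
    swap₁ : ∀ m s t → leaves₁ m t s ≡ leaves₁ (opposite m) s t
    swap₁ Sign.+ Sign.+ Sign.+ = refl
    swap₁ Sign.+ Sign.+ Sign.- = refl
    swap₁ Sign.+ Sign.- Sign.+ = refl
    swap₁ Sign.+ Sign.- Sign.- = refl
    swap₁ Sign.- Sign.+ Sign.+ = refl
    swap₁ Sign.- Sign.+ Sign.- = refl
    swap₁ Sign.- Sign.- Sign.+ = refl
    swap₁ Sign.- Sign.- Sign.- = refl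

  same≡leaves∧leaves : ∀ {n} (x y : Cube n) → same x y ≡ leaves Sign.+ x y ∧ leaves Sign.- x y
  same≡leaves∧leaves []           []           = refl
  same≡leaves∧leaves (Sign.+ ∷ x) (Sign.+ ∷ y) = same≡leaves∧leaves x y
  same≡leaves∧leaves (Sign.- ∷ x) (Sign.- ∷ y) = same≡leaves∧leaves x y
  same≡leaves∧leaves (Sign.+ ∷ x) (Sign.- ∷ y) = sym (Bool.∧-zeroʳ _)
  same≡leaves∧leaves (Sign.- ∷ x) (Sign.+ ∷ y) = refl

  same-sym : ∀ {n} (x y : Cube n) → same y x ≡ same x y
  same-sym x y = trans (same≡leaves∧leaves y x)
    (trans (cong₂ _∧_ (leaves-swap Sign.+ x y) (leaves-swap Sign.- x y))
      (trans (Bool.∧-comm (leaves Sign.- x y) _) (sym (same≡leaves∧leaves x y))))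

  leaves-+⇒⊒ : ∀ {n} (x y : Cube n) → T (leaves Sign.+ x y) → y ⊑ x
  leaves-+⇒⊒ []           []           _ = []
  leaves-+⇒⊒ (Sign.+ ∷ x) (Sign.+ ∷ y) l = ℤ.≤-refl ∷ leaves-+⇒⊒ x y l
  leaves-+⇒⊒ (Sign.+ ∷ x) (Sign.- ∷ y) l = ℤ.-≤+ ∷ leaves-+⇒⊒ x y l
  leaves-+⇒⊒ (Sign.- ∷ x) (Sign.- ∷ y) l = ℤ.≤-refl ∷ leaves-+⇒⊒ x y l

  leaves--⇒⊑ : ∀ {n} (x y : Cube n) → T (leaves Sign.- x y) → x ⊑ y
  leaves--⇒⊑ x y l = leaves-+⇒⊒ y x (subst T (sym (leaves-swap Sign.+ x y)) l)

  -- The inequality at a single pair of points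

  all-sign? : {P : Sign → Set} → (∀ s → Dec (P s)) → Dec (∀ s → P s)
  all-sign? P? with P? Sign.+ | P? Sign.-
  ... | yes p | yes m = yes λ { Sign.+ → p ; Sign.- → m }
  ... | no ¬p | _     = no λ h → ¬p (h Sign.+)
  ... | yes _ | no ¬m = no λ h → ¬m (h Sign.-)

  all-bool? : {P : Bool → Set} → (∀ b → Dec (P b)) → Dec (∀ b → P b)
  all-bool? P? with P? true | P? false
  ... | yes p | yes m = yes λ { true → p ; false → m }
  ... | no ¬p | _     = no λ h → ¬p (h true)
  ... | yes _ | no ¬m = no λ h → ¬m (h false)

  _≤ₛ?_ : ∀ s t → Dec (s ≤ₛ t)
  s ≤ₛ? t = toℤ s ℤ.≤? toℤ t

  -- b and c say that every difference is a + resp. a − of x; f and g are the two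
  -- functions compared, evaluated at x and at y.
  local-bound : (b c : Bool) (fx fy gx gy : Sign) → ℚ
  local-bound b c fx fy gx gy =
    ⟦ gx ⟧ * ⟦ gy ⟧ + (Δ fx gx * κ-value (- 1ℚ) (if is Sign.+ gx then b else c) (b ∧ c)
                     + Δ fy gy * κ-value (- 1ℚ) (if is Sign.+ gy then c else b) (b ∧ c))

  -- Decided on all 64 cases. The informative one is `b` without `c`: there the bound equals gx gy +
  -- gx - gy - (fx - fy). The expression st + s - t is at most 1, with equality unless s is - and t
  -- is +, which monotonicity excludes for f. With neither, each disagreement costs 1; with both, fx
  -- = fy.
  local-gap : ∀ b c fx fy gx gy → (T b → fy ≤ₛ fx) → (T c → fx ≤ₛ fy) →
              local-bound b c fx fy gx gy ≤ ⟦ fx ⟧ * ⟦ fy ⟧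
  local-gap = from-yes (all-bool? λ b → all-bool? λ c →
    all-sign? λ fx → all-sign? λ fy → all-sign? λ gx → all-sign? λ gy →
    (T? b →-dec (fy ≤ₛ? fx)) →-dec (T? c →-dec (fx ≤ₛ? fy)) →-dec
    (local-bound b c fx fy gx gy ℚ.≤? ⟦ fx ⟧ * ⟦ fy ⟧))

  κ-noise : ∀ {n} → Sign → Cube n → Cube n → ℚ
  κ-noise m x y = κ-value (- 1ℚ) (leaves m x y) (same x y)

  stability : ℚ → ∀ {n} → (Cube n → Sign) → ℚ
  stability q {n} f = ∑ (cube n) (λ x → ∑ (cube n) (λ y → ⨂ (bsc q) x y * (⟦ f x ⟧ * ⟦ f y ⟧)))

  module Noise {q : ℚ} (0≤q : 0ℚ ≤ q) (q≤1 : q ≤ 1ℚ) where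
    open Powers 0≤q q≤1

    V : ∀ {n} → Cube n → Cube n → ℚ
    V = ⨂ (bsc q)

    V-nonneg : ∀ {n} (x y : Cube n) → 0ℚ ≤ V x y
    V-nonneg = ⨂-nonneg λ
      { Sign.+ Sign.+ → *-nonneg (ℚ.nonNegative⁻¹ ½) 0≤v
      ; Sign.+ Sign.- → *-nonneg (ℚ.nonNegative⁻¹ ½) 0≤q
      ; Sign.- Sign.+ → *-nonneg (ℚ.nonNegative⁻¹ ½) 0≤q
      ; Sign.- Sign.- → *-nonneg (ℚ.nonNegative⁻¹ ½) 0≤v }

    ∑-V : ∀ {n} (x : Cube n) → ∑ (cube n) (V x) ≡ ½ ^ n
    ∑-V x = trans (∑-multiplicative signs V (bsc q) (λ _ → ½) refl (λ _ _ _ _ → refl) row x) (Π-½ x)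
      where
      row : ∀ s → ∑ signs (bsc q s) ≡ ½
      row Sign.+ = solve 1 (λ q → con ½ :* (con 1ℚ :- q) :+ (con ½ :* q :+ con 0ℚ) := con ½) refl q
      row Sign.- = solve 1 (λ q → con ½ :* q :+ (con ½ :* (con 1ℚ :- q) :+ con 0ℚ) := con ½) refl q

    ∑-V-leaves : ∀ m {n} (x : Cube n) →
                 ∑ (cube n) (λ y → V x y * 𝟙 (leaves m x y)) ≡ ½ ^ n * v ^ count (opposite m) x
    ∑-V-leaves m x = trans
      (∑-multiplicative signs (λ x y → V x y * 𝟙 (leaves m x y)) (λ s t → bsc q s t * 𝟙 (leaves₁ m s t)) _
        refl (λ s t x y → 𝟙-∧ (bsc q s t) (V x y) (leaves₁ m s t) (leaves m x y)) (row m) x)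
      (Π-minority m v x)
      where
      row : ∀ m s → ∑ signs (λ t → bsc q s t * 𝟙 (leaves₁ m s t)) ≡ ½ * (if is m s then 1ℚ else v)
      row Sign.+ Sign.+ = solve 1 (λ q → con ½ :* (con 1ℚ :- q) :* con 1ℚ :+ (con ½ :* q :* con 1ℚ :+ con 0ℚ) := con ½ :* con 1ℚ) refl q
      row Sign.+ Sign.- = solve 1 (λ q → con ½ :* q :* con 0ℚ :+ (con ½ :* (con 1ℚ :- q) :* con 1ℚ :+ con 0ℚ) := con ½ :* (con 1ℚ :- q)) refl q
      row Sign.- Sign.+ = solve 1 (λ q → con ½ :* (con 1ℚ :- q) :* con 1ℚ :+ (con ½ :* q :* con 0ℚ :+ con 0ℚ) := con ½ :* (con 1ℚ :- q)) refl q
      row Sign.- Sign.- = solve 1 (λ q → con ½ :* q :* con 1ℚ :+ (con ½ :* (con 1ℚ :- q) :* con 1ℚ :+ con 0ℚ) := con ½ :* con 1ℚ) refl q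

    ∑-V-same : ∀ {n} (x : Cube n) → ∑ (cube n) (λ y → V x y * 𝟙 (same x y)) ≡ ½ ^ n * v ^ n
    ∑-V-same x = trans
      (∑-multiplicative signs (λ x y → V x y * 𝟙 (same x y)) (λ s t → bsc q s t * 𝟙 (is s t)) (λ _ → ½ * v)
        refl (λ s t x y → 𝟙-∧ (bsc q s t) (V x y) (is s t) (same x y)) row x)
      (Π-all v x)
      where
      row : ∀ s → ∑ signs (λ t → bsc q s t * 𝟙 (is s t)) ≡ ½ * v
      row Sign.+ = solve 2 (λ a b → a :* con 1ℚ :+ (b :* con 0ℚ :+ con 0ℚ) := a) refl (½ * v) (½ * q)
      row Sign.- = solve 2 (λ a b → b :* con 0ℚ :+ (a :* con 1ℚ :+ con 0ℚ) := a) refl (½ * v) (½ * q)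

    S : ∀ {n} → (Cube n → Sign) → ℚ
    S = stability q

    S-flip : ∀ {n} (a : Cube n) (f : Cube n → Sign) → S (f ∘ flip a) ≡ S f
    S-flip {n} a f = trans
      (∑-cong (cube n) λ x → trans
        (∑-cong (cube n) λ y → cong (_* (⟦ f (flip a x) ⟧ * ⟦ f (flip a y) ⟧)) (sym (⨂-flip (bsc-act q) a x y)))
        (∑-flip a (λ y → V (flip a x) y * (⟦ f (flip a x) ⟧ * ⟦ f y ⟧))))
      (∑-flip a (λ x → ∑ (cube n) (λ y → V x y * (⟦ f x ⟧ * ⟦ f y ⟧))))

    -- Averaging over the symmetric channel

    module _ {n} {f : Cube n → Sign} (mono : Monotone f) (M : Cube n → Sign) where
      private
        xs = cube n
        D : Cube n → ℚ
        D x = Δ (f x) (M x)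
        g : Cube n → Cube n → ℚ
        g x y = D x * κ-noise (M x) x y

      pointwise-gap : ∀ x y → ⟦ M x ⟧ * ⟦ M y ⟧ + (g x y + g y x) ≤ ⟦ f x ⟧ * ⟦ f y ⟧
      pointwise-gap x y = subst (λ t → ⟦ M x ⟧ * ⟦ M y ⟧ + t ≤ ⟦ f x ⟧ * ⟦ f y ⟧)
        (sym (cong₂ (λ t u → D x * t + D y * u) (forward (M x)) (backward (M y))))
        (local-gap b c (f x) (f y) (M x) (M y)
          (λ l → mono (leaves-+⇒⊒ x y l)) (λ l → mono (leaves--⇒⊑ x y l)))
        where
        b = leaves Sign.+ x y
        c = leaves Sign.- x y
        forward : ∀ m → κ-noise m x y ≡ κ-value (- 1ℚ) (if is Sign.+ m then b else c) (b ∧ c)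
        forward Sign.+ = cong (κ-value (- 1ℚ) b) (same≡leaves∧leaves x y)
        forward Sign.- = cong (κ-value (- 1ℚ) c) (same≡leaves∧leaves x y)
        backward : ∀ m → κ-noise m y x ≡ κ-value (- 1ℚ) (if is Sign.+ m then c else b) (b ∧ c)
        backward Sign.+ = cong₂ (κ-value (- 1ℚ)) (leaves-swap Sign.+ x y) (trans (same-sym x y) (same≡leaves∧leaves x y))
        backward Sign.- = cong₂ (κ-value (- 1ℚ)) (leaves-swap Sign.- x y) (trans (same-sym x y) (same≡leaves∧leaves x y))

      G : ℚ
      G = ∑ xs (λ x → ∑ xs (λ y → V x y * g x y))

      -- The kernel `V` is symmetric, so the disagreement at y contributes the same total as the
      -- disagreement at x; hence two copies of `G`.
      S-gap-G : S M + (G + G) ≤ S f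
      S-gap-G = begin
        S M + (G + G)                                        ≡⟨ cong (λ t → S M + (G + t)) transposed ⟩
        S M + (G + ∑ xs (λ x → ∑ xs (λ y → V x y * g y x)))  ≡⟨ cong (S M +_) (∑∑-+ (λ x y → V x y * g x y) (λ x y → V x y * g y x)) ⟨
        S M + ∑ xs (λ x → ∑ xs (λ y → V x y * g x y + V x y * g y x))   
          ≡⟨ ∑∑-+ (λ x y → V x y * (⟦ M x ⟧ * ⟦ M y ⟧)) (λ x y → V x y * g x y + V x y * g y x) ⟨
        ∑ xs (λ x → ∑ xs (λ y → V x y * (⟦ M x ⟧ * ⟦ M y ⟧) + (V x y * g x y + V x y * g y x)))
          ≤⟨ ∑-mono xs (λ x → ∑-mono xs (term x)) ⟩
        S f                                                  ∎
        where
        open ℚ.≤-Reasoning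
        ∑∑-+ : ∀ (a b : Cube n → Cube n → ℚ) → ∑ xs (λ x → ∑ xs (λ y → a x y + b x y))
             ≡ ∑ xs (λ x → ∑ xs (a x)) + ∑ xs (λ x → ∑ xs (b x))
        ∑∑-+ a b = trans (∑-cong xs (λ x → ∑-+ xs (a x) (b x))) (∑-+ xs (λ x → ∑ xs (a x)) (λ x → ∑ xs (b x)))
        transposed : G ≡ ∑ xs (λ x → ∑ xs (λ y → V x y * g y x))
        transposed = trans (∑-swap xs xs (λ x y → V x y * g x y))
          (∑-cong xs λ x → ∑-cong xs λ y → cong (_* g y x) (⨂-sym (bsc-sym q) y x))
        term : ∀ x y → V x y * (⟦ M x ⟧ * ⟦ M y ⟧) + (V x y * g x y + V x y * g y x) ≤ V x y * (⟦ f x ⟧ * ⟦ f y ⟧)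
        term x y = ℚ.≤-trans
          (ℚ.≤-reflexive (solve 4 (λ v m a b → v :* m :+ (v :* a :+ v :* b) := v :* (m :+ (a :+ b))) refl
            (V x y) (⟦ M x ⟧ * ⟦ M y ⟧) (g x y) (g y x)))
          (*-monoˡ (V-nonneg x y) (pointwise-gap x y))

      G-bound : ∀ {c} → (∀ x → c ≤ ∑ xs (λ y → V x y * κ-noise (M x) x y)) → c * distance f M ≤ G
      G-bound {c} bound = ℚ.≤-trans (ℚ.≤-reflexive (sym (∑-* xs c D))) (∑-mono xs λ x → begin
        c * D x                                              ≡⟨ ℚ.*-comm c (D x) ⟩
        D x * c                                              ≤⟨ *-monoˡ 0≤∣ ⟦ f x ⟧ - ⟦ M x ⟧ ∣ (bound x) ⟩
        D x * ∑ xs (λ y → V x y * κ-noise (M x) x y)         ≡⟨ ∑-* xs (D x) (λ y → V x y * κ-noise (M x) x y) ⟨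
        ∑ xs (λ y → D x * (V x y * κ-noise (M x) x y))
          ≡⟨ ∑-cong xs (λ y → solve 3 (λ d w k → d :* (w :* k) := w :* (d :* k)) refl (D x) (V x y) (κ-noise (M x) x y)) ⟩
        ∑ xs (λ y → V x y * g x y)                           ∎)
        where open ℚ.≤-Reasoning

    S-gap : ∀ k {f : Cube (suc (k ℕ.+ k)) → Sign} → Monotone f →
      let n = suc (k ℕ.+ k)
          c = ½ ^ n * (q * (1ℚ - ι k * (ι k + 2ℚ) * q))
      in S (Maj n) + (c + c) * distance f (Maj n) ≤ S f
    S-gap k {f} mono = ℚ.≤-trans
      (ℚ.+-monoʳ-≤ (S (Maj n)) (ℚ.≤-trans (ℚ.≤-reflexive (ℚ.*-distribʳ-+ (distance f (Maj n)) c c)) (ℚ.+-mono-≤ c≤G c≤G)))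
      (S-gap-G mono (Maj n))
      where
      n : ℕ
      n = suc (k ℕ.+ k)
      h c : ℚ
      h = ½ ^ n
      c = h * (q * (1ℚ - ι k * (ι k + 2ℚ) * q))
      weight-sum : ∀ m x → ∑ (cube n) (λ y → V x y * κ-noise m x y) ≡ h * (2ℚ * v ^ count (opposite m) x - 1ℚ + - 1ℚ * v ^ n)
      weight-sum m x = trans (∑-κ (cube n) (V x) (λ y → 𝟙 (leaves m x y)) (λ y → 𝟙 (same x y)) (- 1ℚ))
        (trans (cong₂ (λ a b → a + - 1ℚ * b) (cong₂ (λ a b → 2ℚ * a - b) (∑-V-leaves m x) (∑-V x)) (∑-V-same x))
          (factor h (v ^ count (opposite m) x) (- 1ℚ) (v ^ n)))
      c≤G : c * distance f (Maj n) ≤ G mono (Maj n)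
      c≤G = G-bound mono (Maj n) {c} λ x →
        ℚ.≤-trans (*-monoˡ (½^-nonneg n) (pure-bound k (Maj-minority k x)))
          (ℚ.≤-reflexive (sym (weight-sum (Maj n x) x)))

  -- The thresholds γ and γ′

  toℚᵘ-/ : ∀ a d → toℚᵘ (ℤ.+ a / suc d) ℚᵘ.≃ ℚᵘ.mkℚᵘ (ℤ.+ a) d
  toℚᵘ-/ a d = ℚ.toℚᵘ-fromℚᵘ (ℚᵘ.mkℚᵘ (ℤ.+ a) d)

  ι≡/1 : ∀ n → ι n ≡ ℤ.+ n / 1
  ι≡/1 zero    = refl
  ι≡/1 (suc n) = trans (cong (1ℚ +_) (ι≡/1 n)) (ℚ.toℚᵘ-injective (begin-equality
    toℚᵘ (1ℚ + (ℤ.+ n / 1))                ≃⟨ ℚ.toℚᵘ-homo-+ 1ℚ (ℤ.+ n / 1) ⟩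
    ℚᵘ.1ℚᵘ ℚᵘ.+ toℚᵘ (ℤ.+ n / 1)           ≃⟨ ℚᵘ.+-congʳ ℚᵘ.1ℚᵘ (toℚᵘ-/ n 0) ⟩
    ℚᵘ.1ℚᵘ ℚᵘ.+ ℚᵘ.mkℚᵘ (ℤ.+ n) 0          ≡⟨ cong (λ z → ℚᵘ.mkℚᵘ (ℤ._+_ ℤ.1ℤ z) 0) (ℤ.*-identityʳ (ℤ.+ n)) ⟩
    ℚᵘ.mkℚᵘ (ℤ.+ suc n) 0                  ≃⟨ toℚᵘ-/ (suc n) 0 ⟨
    toℚᵘ (ℤ.+ suc n / 1)                   ∎))
    where open ℚᵘ.≤-Reasoning

  /*ι : ∀ a d .{{_ : ℕ.NonZero d}} → (ℤ.+ a / d) * ι d ≡ ι a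
  /*ι a (suc d) = trans (cong ((ℤ.+ a / suc d) *_) (ι≡/1 (suc d))) (trans (ℚ.toℚᵘ-injective (begin-equality
    toℚᵘ ((ℤ.+ a / suc d) * (ℤ.+ suc d / 1))            ≃⟨ ℚ.toℚᵘ-homo-* (ℤ.+ a / suc d) (ℤ.+ suc d / 1) ⟩
    toℚᵘ (ℤ.+ a / suc d) ℚᵘ.* toℚᵘ (ℤ.+ suc d / 1)      ≃⟨ ℚᵘ.*-cong (toℚᵘ-/ a d) (toℚᵘ-/ (suc d) 0) ⟩
    ℚᵘ.mkℚᵘ (ℤ.+ a) d ℚᵘ.* ℚᵘ.mkℚᵘ (ℤ.+ suc d) 0
      ≃⟨ ℚᵘ.*≡* (trans (ℤ.*-identityʳ _) (cong (λ z → ℤ.+ a ℤ.* ℤ.+ z) (sym (ℕ.*-identityʳ (suc d))))) ⟩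
    ℚᵘ.mkℚᵘ (ℤ.+ a) 0                                 ≃⟨ toℚᵘ-/ a 0 ⟨
    toℚᵘ (ℤ.+ a / 1)                                  ∎)) (sym (ι≡/1 a)))
    where open ℚᵘ.≤-Reasoning

  /-nonneg : ∀ a d .{{_ : ℕ.NonZero d}} → 0ℚ ≤ ℤ.+ a / d
  /-nonneg a d = ℚ.nonNegative⁻¹ (ℤ.+ a / d) {{ℚ.normalize-nonNeg a d}}

  archimedean : ∀ {ε} → 0ℚ < ε → ∃ λ d → 1ℚ ≤ ε * ι d
  archimedean {ε@(mkℚ (ℤ.+ zero) d _)}        0<ε = contradiction (ℚ.drop-*<* 0<ε) (ℤ.<-irrefl refl)
  archimedean {ε@(mkℚ ℤ.-[1+ _ ] d _)}      0<ε = contradiction (ℚ.drop-*<* 0<ε) λ ()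
  archimedean {ε@(mkℚ (ℤ.+ suc a) d _)}       0<ε = suc d , ℚ.≤-trans
    (≤-by (ι a) (ι-nonneg a) refl)
    (ℚ.≤-reflexive (sym (trans (cong (_* ι (suc d)) (sym (ℚ.↥p/↧p≡p ε))) (/*ι (suc a) (suc d)))))

  γ-defect : ℕ → ℚ
  γ-defect n = ℤ.+ 4 / 1 - γ n * (ℤ.+ (n ℕ.* n) / 1)

  γ-defect-eq : ∀ n → γ n * (ℤ.+ (n ℕ.* n) / 1) ≡ ℤ.+ 4 / 1 - γ-defect n
  γ-defect-eq n = solve 2 (λ a b → a := b :- (b :- a)) refl (γ n * (ℤ.+ (n ℕ.* n) / 1)) (ℤ.+ 4 / 1)

  -- Replace 4 by γ n times (n+7)(n-1); for n = m + 2 the difference (n+7)(n-1) - n² is 6n - 7 = 6m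
  -- + 5.
  γ-defect≡ : ∀ m → γ-defect (2 ℕ.+ m) ≡ γ (2 ℕ.+ m) * ι (6 ℕ.* m ℕ.+ 5)
  γ-defect≡ m = begin
    ℤ.+ 4 / 1 - g * (ℤ.+ (n ℕ.* n) / 1)
      ≡⟨ cong₂ (λ a b → a - g * b) (sym (/*ι 4 ((n ℕ.+ 7) ℕ.* (n ℕ.∸ 1)))) (sym (ι≡/1 (n ℕ.* n))) ⟩
    g * ι ((n ℕ.+ 7) ℕ.* suc m) - g * ι (n ℕ.* n)
      ≡⟨ cong₂ (λ a b → g * a - g * b)
           (trans (ι-* (n ℕ.+ 7) (suc m)) (cong (_* (1ℚ + ι m)) (ι-+ n 7))) (ι-* n n) ⟩
    g * ((ι n + ι 7) * (1ℚ + ι m)) - g * (ι n * ι n)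
      ≡⟨ solve 2 (λ g m → let n = con 1ℚ :+ (con 1ℚ :+ m) in
           g :* ((n :+ con (ι 7)) :* (con 1ℚ :+ m)) :- g :* (n :* n) := g :* (con (ι 6) :* m :+ con (ι 5))) refl g (ι m) ⟩
    g * (ι 6 * ι m + ι 5)
      ≡⟨ cong (g *_) (trans (cong (_+ ι 5) (sym (ι-* 6 m))) (sym (ι-+ (6 ℕ.* m) 5))) ⟩
    g * ι (6 ℕ.* m ℕ.+ 5) ∎
    where
    open ≡-Reasoning
    n = 2 ℕ.+ m
    g = γ n

  γ-nonneg : ∀ n → 0ℚ ≤ γ n
  γ-nonneg 0             = ℚ.≤-refl
  γ-nonneg 1             = ℚ.≤-refl
  γ-nonneg (suc (suc m)) = /-nonneg 4 ((2 ℕ.+ m ℕ.+ 7) ℕ.* suc m)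

  γ-defect-vanishing : Vanishing γ-defect
  γ-defect-vanishing ε 0<ε with archimedean 0<ε
  -- Since 6m + 5 ≤ 6(n+7), with slack 49, the defect is at most 24/(n-1). With 1 ≤ εd it is at most
  -- ε as soon as 24d ≤ n - 1.
  ... | d , 1≤εd = 2 ℕ.+ 24 ℕ.* d , close
    where
    close : ∀ n → 2 ℕ.+ 24 ℕ.* d ℕ.≤ n → ∣ γ-defect n ∣ ≤ ε
    close (suc (suc m)) (ℕ.s≤s (ℕ.s≤s 24d≤m)) = subst (_≤ ε)
      (sym (trans (cong ∣_∣ (γ-defect≡ m)) (ℚ.0≤p⇒∣p∣≡p (*-nonneg (γ-nonneg n) (ι-nonneg (6 ℕ.* m ℕ.+ 5))))))
      (ℚ.*-cancelʳ-≤-pos (ι (suc m)) {{positive (ℚ.<-≤-trans (ℚ.positive⁻¹ 1ℚ) (≤-by (ι m) (ι-nonneg m) refl))}} (begin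
        γ n * ι (6 ℕ.* m ℕ.+ 5) * ι (suc m)
          ≡⟨ cong (λ t → γ n * t * ι (suc m)) (trans (ι-+ (6 ℕ.* m) 5) (cong (_+ ι 5) (ι-* 6 m))) ⟩
        γ n * (ι 6 * ι m + ι 5) * ι (suc m)
          ≤⟨ ≤-by (γ n * ι (suc m) * ι 49) (*-nonneg (*-nonneg (γ-nonneg n) (ι-nonneg (suc m))) (ι-nonneg 49))
               (solve 3 (λ g m m₁ → con (ι 6) :* (g :* ((con 1ℚ :+ (con 1ℚ :+ m) :+ con (ι 7)) :* m₁))
                 := g :* (con (ι 6) :* m :+ con (ι 5)) :* m₁ :+ g :* m₁ :* con (ι 49)) refl (γ n) (ι m) (ι (suc m))) ⟩
        ι 6 * (γ n * ((ι n + ι 7) * ι (suc m)))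
          ≡⟨ cong (λ t → ι 6 * (γ n * t)) (trans (cong (_* ι (suc m)) (sym (ι-+ n 7))) (sym (ι-* (n ℕ.+ 7) (suc m)))) ⟩
        ι 6 * (γ n * ι ((n ℕ.+ 7) ℕ.* suc m))
          ≡⟨ cong (ι 6 *_) (/*ι 4 ((n ℕ.+ 7) ℕ.* suc m)) ⟩
        ι 24 * 1ℚ                          ≤⟨ *-monoˡ (ι-nonneg 24) 1≤εd ⟩
        ι 24 * (ε * ι d)                   ≡⟨ solve 3 (λ a b c → a :* (b :* c) := b :* (a :* c)) refl (ι 24) ε (ι d) ⟩
        ε * (ι 24 * ι d)                   ≡⟨ cong (ε *_) (ι-* 24 d) ⟨
        ε * ι (24 ℕ.* d)                   ≤⟨ *-monoˡ (ℚ.<⇒≤ 0<ε) (ι-mono (ℕ.m≤n⇒m≤1+n 24d≤m)) ⟩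
        ε * ι (suc m)                      ∎))
      where
      open ℚ.≤-Reasoning
      n = 2 ℕ.+ m

  -- With k written as `suc j`, `γ n` and `γ′ n` reduce past their placeholder clauses, `n ∸ 1`
  -- computes to k + k, and the constants of the bounds are at least 1.
  Odd≥3 : ℕ → Set
  Odd≥3 n = ∃ λ j → n ≡ suc (suc j ℕ.+ suc j)

  odd-half : ∀ n → n % 2 ≡ 1 → 5 ℕ.≤ n → Odd≥3 n
  odd-half n odd 5≤n with n ℕ./ 2 | trans (m≡m%n+[m/n]*n n 2) (cong (ℕ._+ n ℕ./ 2 ℕ.* 2) odd)
  ... | zero  | eq = contradiction (subst (5 ℕ.≤_) eq 5≤n) λ { (ℕ.s≤s ()) }
  ... | suc j | eq = j , trans eq (cong suc (trans (ℕ.*-comm (suc j) 2) (cong (suc j ℕ.+_) (ℕ.+-identityʳ (suc j)))))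

  module _ (j : ℕ) where
    private
      k n : ℕ
      k = suc j
      n = suc (k ℕ.+ k)
      K I : ℚ
      K = ι k
      I = ι j

    γ-threshold : K * (K + 2ℚ) * γ n ≤ 1ℚ
    -- As 1/γ = k(k+4), the slack over k(k+2) is 2kγ.
    γ-threshold = ≤-by (2ℚ * K * γ n) (*-nonneg (*-nonneg (ℚ.nonNegative⁻¹ 2ℚ) (ι-nonneg k)) (γ-nonneg n)) (begin
      1ℚ                                               ≡⟨ cong (½ * ½ *_) (/*ι 4 ((n ℕ.+ 7) ℕ.* (k ℕ.+ k))) ⟨
      ½ * ½ * (γ n * ι ((n ℕ.+ 7) ℕ.* (k ℕ.+ k)))
        ≡⟨ cong (λ t → ½ * ½ * (γ n * t)) (trans (ι-* (n ℕ.+ 7) (k ℕ.+ k)) (cong₂ _*_ (ι-+ n 7) (ι-+ k k))) ⟩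
      ½ * ½ * (γ n * ((1ℚ + ι (k ℕ.+ k) + ι 7) * (K + K)))
        ≡⟨ cong (λ t → ½ * ½ * (γ n * ((1ℚ + t + ι 7) * (K + K)))) (ι-+ k k) ⟩
      ½ * ½ * (γ n * ((1ℚ + (K + K) + ι 7) * (K + K)))
        ≡⟨ solve 2 (λ g K → con (½ * ½) :* (g :* ((con 1ℚ :+ (K :+ K) :+ con (ι 7)) :* (K :+ K)))
             := K :* (K :+ con 2ℚ) :* g :+ con 2ℚ :* K :* g) refl (γ n) K ⟩
      K * (K + 2ℚ) * γ n + 2ℚ * K * γ n                ∎)
      where open ≡-Reasoning

    γ′-threshold : K * (2ℚ * K + (2ℚ + 1ℚ)) * γ′ n ≤ 1ℚ
    γ′-threshold = ℚ.≤-reflexive (sym (begin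
      1ℚ                                               ≡⟨ cong (½ *_) (/*ι 2 ((n ℕ.+ 2) ℕ.* (k ℕ.+ k))) ⟨
      ½ * (γ′ n * ι ((n ℕ.+ 2) ℕ.* (k ℕ.+ k)))
        ≡⟨ cong (λ t → ½ * (γ′ n * t)) (trans (ι-* (n ℕ.+ 2) (k ℕ.+ k)) (cong₂ _*_ (ι-+ n 2) (ι-+ k k))) ⟩
      ½ * (γ′ n * ((1ℚ + ι (k ℕ.+ k) + ι 2) * (K + K)))
        ≡⟨ cong (λ t → ½ * (γ′ n * ((1ℚ + t + ι 2) * (K + K)))) (ι-+ k k) ⟩
      ½ * (γ′ n * ((1ℚ + (K + K) + ι 2) * (K + K)))
        ≡⟨ solve 2 (λ g K → con ½ :* (g :* ((con 1ℚ :+ (K :+ K) :+ con (ι 2)) :* (K :+ K)))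
             := K :* (con 2ℚ :* K :+ con (2ℚ + 1ℚ)) :* g) refl (γ′ n) K ⟩
      K * (2ℚ * K + (2ℚ + 1ℚ)) * γ′ n                  ∎))
      where open ≡-Reasoning

    1≤K[K+2] : 1ℚ ≤ K * (K + 2ℚ)
    1≤K[K+2] = ≤-by (2ℚ + (ι 4 * I + I * I))
      (+-nonneg (ℚ.nonNegative⁻¹ 2ℚ) (+-nonneg (*-nonneg (ι-nonneg 4) (ι-nonneg j)) (*-nonneg (ι-nonneg j) (ι-nonneg j))))
      (solve 1 (λ I → (con 1ℚ :+ I) :* ((con 1ℚ :+ I) :+ con 2ℚ) := con 1ℚ :+ (con 2ℚ :+ (con (ι 4) :* I :+ I :* I))) refl I)

    1≤K[2K+3] : 1ℚ ≤ K * (2ℚ * K + (2ℚ + 1ℚ))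
    1≤K[2K+3] = ≤-by (ι 4 + (ι 7 * I + 2ℚ * (I * I)))
      (+-nonneg (ι-nonneg 4) (+-nonneg (*-nonneg (ι-nonneg 7) (ι-nonneg j)) (*-nonneg (ι-nonneg 2) (*-nonneg (ι-nonneg j) (ι-nonneg j)))))
      (solve 1 (λ I → (con 1ℚ :+ I) :* (con 2ℚ :* (con 1ℚ :+ I) :+ con (2ℚ + 1ℚ))
        := con 1ℚ :+ (con (ι 4) :+ (con (ι 7) :* I :+ con 2ℚ :* (I :* I)))) refl I)

  -- Orienting unate functions; distance from majority

  increasing⇒monotone : ∀ {n} (f : Cube n → Sign) → (∀ i → IncreasingIn i f) → Monotone f
  increasing⇒monotone f inc []                              = ℤ.≤-refl
  increasing⇒monotone f inc (_∷_ {x = s} {y = t} {xs = x} s≤t x⊑y) = ℤ.≤-trans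
    (inc zero (s ∷ x) s t s≤t)
    (increasing⇒monotone (f ∘ (t ∷_)) (λ i x → inc (suc i) (t ∷ x)) x⊑y)

  flip-update : ∀ {n} (a x : Cube n) i s → flip a (x [ i ]≔ s) ≡ flip a x [ i ]≔ (Vec.lookup a i Sign.* s)
  flip-update (_ ∷ a) (_ ∷ x) zero    s = refl
  flip-update (b ∷ a) (t ∷ x) (suc i) s = cong (b Sign.* t ∷_) (flip-update a x i s)

  unate⇒monotone : ∀ {n} (f : Cube n → Sign) → Unate f → ∃ λ a → Monotone (f ∘ flip a)
  unate⇒monotone {n} f un = a , increasing⇒monotone (f ∘ flip a) increasing
    where
    Oriented : Fin n → Sign → Set
    Oriented i b = ∀ x s t → s ≤ₛ t → f (x [ i ]≔ (b Sign.* s)) ≤ₛ f (x [ i ]≔ (b Sign.* t))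
    opposite-antitone : ∀ s t → s ≤ₛ t → opposite t ≤ₛ opposite s
    opposite-antitone Sign.+ Sign.+ _ = ℤ.≤-refl
    opposite-antitone Sign.- Sign.- _ = ℤ.≤-refl
    opposite-antitone Sign.- Sign.+ _ = ℤ.-≤+
    opposite-antitone Sign.+ Sign.- ()
    choose : ∀ i → ∃ (Oriented i)
    choose i with un i
    ... | inj₁ inc = Sign.+ , inc
    ... | inj₂ dec = Sign.- , λ x s t s≤t → dec x (opposite t) (opposite s) (opposite-antitone s t s≤t)
    a : Cube n
    a = Vec.tabulate (λ i → proj₁ (choose i))
    oriented : ∀ i → Oriented i (Vec.lookup a i)
    oriented i = subst (Oriented i) (sym (VecP.lookup∘tabulate (λ i → proj₁ (choose i)) i)) (proj₂ (choose i))
    increasing : ∀ i → IncreasingIn i (f ∘ flip a)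
    increasing i x s t s≤t = subst₂ (λ u w → f u ≤ₛ f w) (sym (flip-update a x i s)) (sym (flip-update a x i t))
      (oriented i (flip a x) s t s≤t)

  Δ-distinct : ∀ s t → s ≢ t → 1ℚ ≤ Δ s t
  Δ-distinct Sign.+ Sign.+ s≢t = contradiction refl s≢t
  Δ-distinct Sign.- Sign.- s≢t = contradiction refl s≢t
  Δ-distinct Sign.+ Sign.- _   = ≤-by 1ℚ (ℚ.nonNegative⁻¹ 1ℚ) refl
  Δ-distinct Sign.- Sign.+ _   = ≤-by 1ℚ (ℚ.nonNegative⁻¹ 1ℚ) refl

  distance-nonneg : ∀ {n} (f g : Cube n → Sign) → 0ℚ ≤ distance f g
  distance-nonneg {n} f g = ∑-nonneg (cube n) (λ x → 0≤∣ ⟦ f x ⟧ - ⟦ g x ⟧ ∣)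

  -- Agreement on the finite cube is decidable. Full agreement would exhibit f as a flipped
  -- majority, flips being involutive; otherwise the search returns a point of disagreement, whose
  -- term alone is at least 1. The bound is the same for every `a`.
  distance-Maj : ∀ {n} (f : Cube n → Sign) → ¬ MajUpToFlips f → ∀ a → 1ℚ ≤ distance (f ∘ flip a) (Maj n)
  distance-Maj {n} f notMaj a with All.all? (λ x → f (flip a x) SignP.≟ Maj n x) (cube n)
  ... | yes agree = contradiction
    (a , λ x → trans (cong f (sym (flip-involutive a x))) (All.lookup agree (∈-cube (flip a x)))) notMaj
  ... | no ¬agree with Any.satisfied (¬All⇒Any¬ (λ x → f (flip a x) SignP.≟ Maj n x) (cube n) ¬agree)
  ... | x , differ = ℚ.≤-trans (Δ-distinct _ _ differ)
    (term≤∑ (λ x → Δ (f (flip a x)) (Maj n x)) (λ x → 0≤∣ ⟦ f (flip a x) ⟧ - ⟦ Maj n x ⟧ ∣) (∈-cube x))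

  total-flip : ∀ {n} (a : Cube n) (f : Cube n → Sign) → total (f ∘ flip a) ≡ total f
  total-flip a f = ∑-flip a (⟦_⟧ ∘ f)

open import Data.Integer using (+_)
open import Defs
open Finite

-- From rational to real parameters

seq-Σ : {A : Set} (xs : List A) (g : A → ℝ) (k : ℕ) → seq (Σ∈ xs g) k ≡ ∑ xs (λ x → seq (g x) k)
seq-Σ []       g k = refl
seq-Σ (x ∷ xs) g k = cong (seq (g x) k ℚ.+_) (seq-Σ xs g k)

seq-Σ≡ : {A : Set} (xs : List A) (g : A → ℝ) (h : A → ℚ) (k : ℕ) →
         (∀ x → seq (g x) k ≡ h x) → seq (Σ∈ xs g) k ≡ ∑ xs h
seq-Σ≡ xs g h k eq = trans (seq-Σ xs g k) (∑-cong xs eq)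

seq-⊗ : {E : Set} (μ : Sign → E → ℝ) (c : Sign → E → ℚ) (k : ℕ) → (∀ s e → seq (μ s e) k ≡ c s e) →
        ∀ {n} (x : Cube n) y → seq ((μ ^⊗) x y) k ≡ ⨂ c x y
seq-⊗ μ c k eq []      []      = refl
seq-⊗ μ c k eq (s ∷ x) (e ∷ y) = cong₂ ℚ._*_ (eq s e) (seq-⊗ μ c k eq x y)

-- For terms that are controlled only from some index on; a finite list has a common index.
ev-Σ : {A : Set} (xs : List A) (g : A → ℝ) (h : A → ℕ → ℚ) →
       (∀ x → Eventually λ k → seq (g x) k ≡ h x k) →
       Eventually λ k → seq (Σ∈ xs g) k ≡ ∑ xs (λ x → h x k)
ev-Σ []       g h eq = 0 , λ _ _ → refl
ev-Σ (x ∷ xs) g h eq = ev-map (λ _ (a , b) → cong₂ ℚ._+_ a b) (ev-∩ (eq x) (ev-Σ xs g h eq))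

-- The pairs (x, y) differ in each coordinate with probability (1 − ρ)/2.
noise : ℝ → ℕ → ℚ
noise ρ k = ½ ℚ.* (1ℚ ℚ.- seq ρ k)

seq-Stab : ∀ ρ {n} (f : Cube n → Sign) k → seq (Stab ρ f) k ≡ stability (noise ρ k) f
seq-Stab ρ {n} f k = seq-Σ≡ (cube n)
  (λ x → Σ∈ (cube n) λ y → (DSBS ρ ^⊗) x y * (toℝ (f x) * toℝ (f y)))
  (λ x → ∑ (cube n) (λ y → ⨂ (bsc (noise ρ k)) x y ℚ.* (⟦ f x ⟧ ℚ.* ⟦ f y ⟧))) k
  λ x → seq-Σ≡ (cube n)
    (λ y → (DSBS ρ ^⊗) x y * (toℝ (f x) * toℝ (f y)))
    (λ y → ⨂ (bsc (noise ρ k)) x y ℚ.* (⟦ f x ⟧ ℚ.* ⟦ f y ⟧)) k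
    λ y → cong (ℚ._* (⟦ f x ⟧ ℚ.* ⟦ f y ⟧)) (seq-⊗ (DSBS ρ) (bsc (noise ρ k)) k kernel x y)
  where
  equal : + 1 ℚ./ 4 ℚ.* (1ℚ ℚ.+ seq ρ k) ≡ ½ ℚ.* (1ℚ ℚ.- noise ρ k)
  equal = solve 1 (λ r → con (+ 1 ℚ./ 4) :* (con 1ℚ :+ r)
    := con ½ :* (con 1ℚ :- con ½ :* (con 1ℚ :- r))) refl (seq ρ k)
  distinct : + 1 ℚ./ 4 ℚ.* (1ℚ ℚ.- seq ρ k) ≡ ½ ℚ.* noise ρ k
  distinct = solve 1 (λ r → con (+ 1 ℚ./ 4) :* (con 1ℚ :- r) := con ½ :* (con ½ :* (con 1ℚ :- r))) refl (seq ρ k)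
  kernel : ∀ s t → seq (DSBS ρ s t) k ≡ bsc (noise ρ k) s t
  kernel Sign.+ Sign.+ = equal
  kernel Sign.- Sign.- = equal
  kernel Sign.+ Sign.- = distinct
  kernel Sign.- Sign.+ = distinct

-- Only eventual, because `recip` inverts the maximum of the term and `e`.
seq-recip : ∀ x (0<x : 0ℝ < x) → Eventually λ k → seq x k ℚ.* seq (recip x 0<x) k ≡ 1ℚ
seq-recip x (e , 0<e , K , hK) = K , λ k K≤k →
  let i , _ , inverse = reciprocal (seq x k ℚ.⊔ e) (0<⊔ 0<e (seq x k))
  in trans (cong (ℚ._* i) (sym (ℚ.p≥q⇒p⊔q≡p (subst (ℚ._≤ seq x k) (ℚ.+-identityˡ e) (hK k K≤k))))) inverse

module _ (p : ℝ) (0<p : 0ℝ < p) (p<1 : p < 1ℝ) where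

  seq-SBES : ∀ k {n} (x : Cube n) y → seq ((SBES p ^⊗) x y) k ≡ ⨂ (bec (seq p k)) x y
  seq-SBES k = seq-⊗ (SBES p) (bec (seq p k)) k kernel
    where
    kernel : ∀ s e → seq (SBES p s e) k ≡ bec (seq p k) s e
    kernel Sign.+ nothing       = refl
    kernel Sign.- nothing       = refl
    kernel Sign.+ (just Sign.+) = refl
    kernel Sign.- (just Sign.-) = refl
    kernel Sign.+ (just Sign.-) = refl
    kernel Sign.- (just Sign.+) = refl

  -- Multiplying by Pr[Y = y] cancels the conditioning.
  seq-Φ : ∀ {n} (f : Cube n → Sign) → Eventually λ k → seq (Φ p 0<p p<1 f) k ≡ ∑∣mean∣ (seq p k) f
  seq-Φ {n} f = ev-Σ (erasedCube n) (λ y → PrY p y * abs (𝔼[_∣Y=_] p 0<p p<1 f y)) (λ y k → ∣ mean (seq p k) f y ∣) λ y →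
    ev-map (λ k (nonneg , inverse) → cancel y k nonneg inverse)
      (ev-∩ (pos⇒nonneg {PrY p y} (PrY-pos p 0<p p<1 y)) (seq-recip (PrY p y) (PrY-pos p 0<p p<1 y)))
    where
    cancel : ∀ y k → 0ℚ ℚ.≤ seq (PrY p y) k →
             seq (PrY p y) k ℚ.* seq (recip (PrY p y) (PrY-pos p 0<p p<1 y)) k ≡ 1ℚ →
             seq (PrY p y * abs (𝔼[_∣Y=_] p 0<p p<1 f y)) k ≡ ∣ mean (seq p k) f y ∣
    cancel y k 0≤P Pi≡1 = begin
      P ℚ.* ∣ seq (𝔼[_∣Y=_] p 0<p p<1 f y) k ∣  ≡⟨ cong (λ t → P ℚ.* ∣ t ∣) expectation ⟩
      P ℚ.* ∣ i ℚ.* m ∣                          ≡⟨ cong (ℚ._* ∣ i ℚ.* m ∣) (ℚ.0≤p⇒∣p∣≡p 0≤P) ⟨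
      ∣ P ∣ ℚ.* ∣ i ℚ.* m ∣                      ≡⟨ ℚ.∣p*q∣≡∣p∣*∣q∣ P (i ℚ.* m) ⟨
      ∣ P ℚ.* (i ℚ.* m) ∣                        ≡⟨ cong ∣_∣ (ℚ.*-assoc P i m) ⟨
      ∣ P ℚ.* i ℚ.* m ∣                          ≡⟨ cong (λ t → ∣ t ℚ.* m ∣) Pi≡1 ⟩
      ∣ 1ℚ ℚ.* m ∣                               ≡⟨ cong ∣_∣ (ℚ.*-identityˡ m) ⟩
      ∣ m ∣                                      ∎
      where
      open ≡-Reasoning
      P i m : ℚ
      P = seq (PrY p y) k
      i = seq (recip (PrY p y) (PrY-pos p 0<p p<1 y)) k
      m = mean (seq p k) f y
      expectation : seq (𝔼[_∣Y=_] p 0<p p<1 f y) k ≡ i ℚ.* m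
      expectation = trans
        (seq-Σ≡ (cube n) (λ x → PrX∣Y p 0<p p<1 x y * toℝ (f x))
          (λ x → i ℚ.* (⨂ (bec (seq p k)) x y ℚ.* ⟦ f x ⟧)) k
          λ x → trans
            (cong (λ t → t ℚ.* i ℚ.* ⟦ f x ⟧) (seq-SBES k x y))
            (solve 3 (λ w i s → w :* i :* s := i :* (w :* s)) refl (⨂ (bec (seq p k)) x y) i ⟦ f x ⟧))
        (∑-* (cube n) i (λ x → ⨂ (bec (seq p k)) x y ℚ.* ⟦ f x ⟧))

small⇒0 : ∀ {c} → (∀ ε → 0ℚ ℚ.< ε → ∣ c ∣ ℚ.≤ ε) → c ≡ 0ℚ
small⇒0 {c} small with ∣ c ∣ ℚ.≤? 0ℚ
... | yes ∣c∣≤0 = ℚ.∣p∣≡0⇒p≡0 c (ℚ.≤-antisym ∣c∣≤0 0≤∣ c ∣)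
... | no  ∣c∣≰0 with ℚ.<-dense (ℚ.≰⇒> ∣c∣≰0)
...   | ε , 0<ε , ε<∣c∣ = contradiction (ℚ.<-≤-trans ε<∣c∣ (small ε 0<ε)) (ℚ.<-irrefl refl)

-- The bias is a constant rational sequence, so being arbitrarily close to 0 forces it to be exactly
-- 0.
unbiased⇒total≡0 : ∀ {n} (f : Cube n → Sign) → Unbiased f → total f ≡ 0ℚ
unbiased⇒total≡0 {n} f unbiased = begin
  total f                              ≡⟨ ℚ.*-identityˡ (total f) ⟨
  1ℚ ℚ.* total f                       ≡⟨ cong (ℚ._* total f) (/*ι 1 (2 ℕ.^ n) {{ℕ.m^n≢0 2 n}}) ⟨
  u ℚ.* ι (2 ℕ.^ n) ℚ.* total f        ≡⟨ solve 3 (λ u w t → u :* w :* t := w :* (u :* t)) refl u (ι (2 ℕ.^ n)) (total f) ⟩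
  ι (2 ℕ.^ n) ℚ.* (u ℚ.* total f)      ≡⟨ cong (ι (2 ℕ.^ n) ℚ.*_) ut≡0 ⟩
  ι (2 ℕ.^ n) ℚ.* 0ℚ                   ≡⟨ ℚ.*-zeroʳ (ι (2 ℕ.^ n)) ⟩
  0ℚ                                   ∎
  where
  open ≡-Reasoning
  u : ℚ
  u = (+ 1 ℚ./ (2 ℕ.^ n)) {{ℕ.m^n≢0 2 n}}
  ut≡0 : u ℚ.* total f ≡ 0ℚ
  ut≡0 = small⇒0 λ ε 0<ε → let N , h = unbiased ε 0<ε in
    subst (λ t → ∣ t ∣ ℚ.≤ ε)
      (trans (ℚ.+-identityʳ _) (trans (seq-Σ (cube n) (λ x → uniform x * toℝ (f x)) N) (∑-* (cube n) u (⟦_⟧ ∘ f))))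
      (h N ℕ.≤-refl)

-- The flip a may vary with k: without unateness it is read off the signs of
-- rational approximations, which need not stabilise.
Gap : ∀ {n} → (Cube n → Sign) → ℝ → ℝ → Set
Gap {n} f X Y = ∃ λ c → 0ℚ ℚ.< c × Eventually λ k →
  ∃ λ a → seq X k ℚ.+ c ℚ.* distance (f ∘ flip a) (Maj n) ℚ.≤ seq Y k

-- The weak inequality uses only that distances are nonnegative. For the strict one `distance-Maj`
-- bounds them by 1 below, and `c` itself witnesses the real inequality.
gap⇒≤∧< : ∀ {n} (f : Cube n → Sign) X Y → Gap f X Y → X ≤ Y × (¬ MajUpToFlips f → X < Y)
gap⇒≤∧< {n} f X Y (c , 0<c , ev) = weak , strict
  where
  weak : X ≤ Y
  weak ε 0<ε = ev-map (λ k (a , gap) → ℚ.≤-trans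
    (≤-by (c ℚ.* distance (f ∘ flip a) (Maj n)) (*-nonneg (ℚ.<⇒≤ 0<c) (distance-nonneg (f ∘ flip a) (Maj n))) refl)
    (ℚ.≤-trans gap (≤-by ε (ℚ.<⇒≤ 0<ε) refl))) ev
  strict : ¬ MajUpToFlips f → X < Y
  strict notMaj = c , 0<c , ev-map (λ k (a , gap) → ℚ.≤-trans
    (ℚ.+-monoʳ-≤ (seq X k) (subst (ℚ._≤ c ℚ.* distance (f ∘ flip a) (Maj n)) (ℚ.*-identityʳ c)
      (*-monoˡ (ℚ.<⇒≤ 0<c) (distance-Maj f notMaj a)))) gap) ev

gap-weaken : ∀ X {c c′ d Y} → c ℚ.≤ c′ → 0ℚ ℚ.≤ d → X ℚ.+ c′ ℚ.* d ℚ.≤ Y → X ℚ.+ c ℚ.* d ℚ.≤ Y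
gap-weaken X {d = d} c≤c′ 0≤d le =
  ℚ.≤-trans (ℚ.+-monoʳ-≤ X (ℚ.*-monoʳ-≤-nonNeg d {{ℚ.nonNegative 0≤d}} c≤c′)) le

range : ∀ {q e e′ g} → 0ℚ ℚ.< e → 0ℚ ℚ.< e′ → g ℚ.≤ 1ℚ → e ℚ.≤ q → q ℚ.+ e′ ℚ.≤ g → 0ℚ ℚ.≤ q × q ℚ.≤ 1ℚ
range {e′ = e′} 0<e 0<e′ g≤1 e≤q q+e′≤g =
  ℚ.≤-trans (ℚ.<⇒≤ 0<e) e≤q , ℚ.≤-trans (≤-by e′ (ℚ.<⇒≤ 0<e′) refl) (ℚ.≤-trans q+e′≤g g≤1)

-- Gaps for real parameters

Stab-gap : ∀ n → Odd≥3 n → (f : Cube n → Sign) → Unate f → ∀ ρ → 1ℝ - fromℚ (+ 2 ℚ./ 1) * fromℚ (γ n) < ρ → ρ < 1ℝ →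
           Gap f (Stab ρ (Maj n)) (Stab ρ f)
Stab-gap n (j , refl) f unate ρ (e , 0<e , lower) (e′ , 0<e′ , upper) =
  let a , mono = unate⇒monotone f unate
      -- The map from ρ to q = (1 - ρ)/2 reverses and halves the interval: the margin e′ below ρ = 1
      -- becomes ½ e′ above q = 0, and the margin e above 1 - 2γ becomes ½ e below γ.
      d  = ½ ℚ.* e′ ; 0<d  = *-pos (ℚ.positive⁻¹ ½) 0<e′
      d′ = ½ ℚ.* e  ; 0<d′ = *-pos (ℚ.positive⁻¹ ½) 0<e
  in h ℚ.* (d ℚ.* d′) , *-pos h-pos (*-pos 0<d 0<d′) , ev-map (λ k (lo , up) →
    let q    = noise ρ k
        r    = seq ρ k
        d≤q : d ℚ.≤ q
        d≤q = ≤-by (½ ℚ.* (1ℚ ℚ.- (r ℚ.+ e′))) (*-nonneg (ℚ.nonNegative⁻¹ ½) (≤⇒0≤- up))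
          (solve 2 (λ r e → con ½ :* (con 1ℚ :- r) := con ½ :* e :+ con ½ :* (con 1ℚ :- (r :+ e))) refl r e′)
        q+d′≤γ : q ℚ.+ d′ ℚ.≤ γ n
        q+d′≤γ = ≤-by (½ ℚ.* (r ℚ.- (1ℚ ℚ.- (+ 2 ℚ./ 1) ℚ.* γ n ℚ.+ e))) (*-nonneg (ℚ.nonNegative⁻¹ ½) (≤⇒0≤- lo))
          (solve 3 (λ r e g → g := con ½ :* (con 1ℚ :- r) :+ con ½ :* e :+ con ½ :* (r :- (con 1ℚ :- con (+ 2 ℚ./ 1) :* g :+ e)))
            refl r e (γ n))
        0≤q , q≤1 = range 0<d 0<d′ (γ≤1 n) d≤q q+d′≤γ
        c = h ℚ.* (q ℚ.* (1ℚ ℚ.- ι m ℚ.* (ι m ℚ.+ 2ℚ) ℚ.* q))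
        hdd′≤c : h ℚ.* (d ℚ.* d′) ℚ.≤ c
        hdd′≤c = *-monoˡ (ℚ.<⇒≤ h-pos)
          (below-threshold (ℚ.<⇒≤ 0<d) (ℚ.<⇒≤ 0<d′) (1≤K[K+2] j) (γ-threshold j) d≤q q+d′≤γ)
        0≤c = ℚ.≤-trans (ℚ.<⇒≤ (*-pos h-pos (*-pos 0<d 0<d′))) hdd′≤c
    in a , subst₂ ℚ._≤_
      (cong (ℚ._+ h ℚ.* (d ℚ.* d′) ℚ.* distance (f ∘ flip a) (Maj n)) (sym (seq-Stab ρ (Maj n) k)))
      (trans (Noise.S-flip 0≤q q≤1 a f) (sym (seq-Stab ρ f k)))
      (gap-weaken (stability q (Maj n)) (ℚ.≤-trans hdd′≤c (≤-by c 0≤c refl)) (distance-nonneg (f ∘ flip a) (Maj n))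
        (Noise.S-gap 0≤q q≤1 m {f ∘ flip a} mono)))
    (ev-∩ lower upper)
  where
  m = suc j
  h = ½ ^ n
  h-pos = ½^-pos n

-- Common to the unate and the general case, which differ in the constant `B`, the threshold `g` and
-- the choice of flip; `a` comes after `q` since the orientation may depend on it. The margins in 0
-- < p and p < g hold at all late indices, so the gap constant h e e′ does not depend on the index.
Φ-gap-eventually : ∀ n (f : Cube n → Sign) → Unbiased f → ∀ B g → 1ℚ ℚ.≤ B → B ℚ.* g ℚ.≤ 1ℚ → g ℚ.≤ 1ℚ →
  (∀ {q} (0≤q : 0ℚ ℚ.≤ q) (q≤1 : q ℚ.≤ 1ℚ) → total f ≡ 0ℚ → ∃ λ a →
    ∑∣mean∣ q (f ∘ flip a) ℚ.+ ½ ^ n ℚ.* (q ℚ.* (1ℚ ℚ.- B ℚ.* q)) ℚ.* distance (f ∘ flip a) (Maj n) ℚ.≤ ∑∣mean∣ q (Maj n)) →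
  ∀ p (0<p : 0ℝ < p) (p<1 : p < 1ℝ) → p < fromℚ g → Gap f (Φ p 0<p p<1 f) (Φ p 0<p p<1 (Maj n))
Φ-gap-eventually n f unbiased B g 1≤B Bg≤1 g≤1 gap p 0<p@(e , 0<e , lower) p<1 (e′ , 0<e′ , upper) =
  h ℚ.* (e ℚ.* e′) , *-pos h-pos (*-pos 0<e 0<e′) , ev-map (λ k ((lo , up) , (Φf , ΦM)) →
    let q   = seq p k
        e≤q = subst (ℚ._≤ q) (ℚ.+-identityˡ e) lo
        0≤q , q≤1 = range 0<e 0<e′ g≤1 e≤q up
        a , le = gap 0≤q q≤1 (unbiased⇒total≡0 f unbiased)
    in a , subst₂ ℚ._≤_
      (cong (ℚ._+ h ℚ.* (e ℚ.* e′) ℚ.* distance (f ∘ flip a) (Maj n))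
        (trans (Erasure.Φ-flip 0≤q q≤1 a f) (sym Φf)))
      (sym ΦM)
      (gap-weaken (∑∣mean∣ q (f ∘ flip a)) (*-monoˡ (ℚ.<⇒≤ h-pos) (below-threshold (ℚ.<⇒≤ 0<e) (ℚ.<⇒≤ 0<e′) 1≤B Bg≤1 e≤q up))
        (distance-nonneg (f ∘ flip a) (Maj n)) le))
    (ev-∩ (ev-∩ lower upper) (ev-∩ (seq-Φ p 0<p p<1 f) (seq-Φ p 0<p p<1 (Maj n))))
  where
  h = ½ ^ n
  h-pos = ½^-pos n

Φ-gap-unate : ∀ n → Odd≥3 n → (f : Cube n → Sign) → Unate f → Unbiased f → ∀ p (0<p : 0ℝ < p) (p<1 : p < 1ℝ) →
              p < fromℚ (γ n) → Gap f (Φ p 0<p p<1 f) (Φ p 0<p p<1 (Maj n))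
Φ-gap-unate n (j , refl) f unate unbiased = Φ-gap-eventually n f unbiased (ι (suc j) ℚ.* (ι (suc j) ℚ.+ 2ℚ)) (γ n)
  (1≤K[K+2] j) (γ-threshold j) (γ≤1 n) λ 0≤q q≤1 tf≡0 →
    let a , mono = unate⇒monotone f unate
    in a , Erasure.Φ-gap-monotone 0≤q q≤1 (suc j) {f ∘ flip a} mono (trans (total-flip a f) tf≡0)

Φ-gap-general : ∀ n → Odd≥3 n → (f : Cube n → Sign) → Unbiased f → ∀ p (0<p : 0ℝ < p) (p<1 : p < 1ℝ) →
                p < fromℚ (γ′ n) → Gap f (Φ p 0<p p<1 f) (Φ p 0<p p<1 (Maj n))
Φ-gap-general n (j , refl) f unbiased = Φ-gap-eventually n f unbiased (ι (suc j) ℚ.* (2ℚ ℚ.* ι (suc j) ℚ.+ (2ℚ ℚ.+ 1ℚ))) (γ′ n)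
  (1≤K[2K+3] j) (γ′-threshold j) (γ′≤1 n) λ 0≤q q≤1 tf≡0 →
    let a , pos = Erasure.orientation 0≤q q≤1 f tf≡0
    in a , Erasure.Φ-gap-oriented 0≤q q≤1 (suc j) {f ∘ flip a} pos (trans (total-flip a f) tf≡0)

theorem10 : (∃ λ (δ : ℕ → ℚ) → Vanishing δ ×
    (∀ n → γ n ℚ.* (+ (n ℕ.* n) ℚ./ 1) ≡ + 4 ℚ./ 1 ℚ.- δ n)) ×
    (∀ n → n % 2 ≡ 1 → 5 ℕ.≤ n →
    (∀ (f : Cube n → Sign) → Unate f → Unbiased f →
    (∀ ρ → 1ℝ - fromℚ (+ 2 ℚ./ 1) * fromℚ (γ n) < ρ → ρ < 1ℝ →
    Stab ρ (Maj n) ≤ Stab ρ f ×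
    (¬ MajUpToFlips f → Stab ρ (Maj n) < Stab ρ f)) ×
    (∀ p (0<p : 0ℝ < p) (p<γ : p < fromℚ (γ n)) →
    let p<1 = <γ⇒<1 n p p<γ in
    Φ p 0<p p<1 f ≤ Φ p 0<p p<1 (Maj n) ×
    (¬ MajUpToFlips f → Φ p 0<p p<1 f < Φ p 0<p p<1 (Maj n)))) ×
    (∀ (f : Cube n → Sign) → Unbiased f →
    ∀ p (0<p : 0ℝ < p) (p<γ′ : p < fromℚ (γ′ n)) →
    let p<1 = <γ′⇒<1 n p p<γ′ in
    Φ p 0<p p<1 f ≤ Φ p 0<p p<1 (Maj n) ×
    (¬ MajUpToFlips f → Φ p 0<p p<1 f < Φ p 0<p p<1 (Maj n))))
theorem10 =
  (γ-defect , γ-defect-vanishing , γ-defect-eq) , λ n odd 5≤n → let half = odd-half n odd 5≤n in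
  (λ f unate unbiased →
    (λ ρ lo hi → gap⇒≤∧< f (Stab ρ (Maj n)) (Stab ρ f) (Stab-gap n half f unate ρ lo hi)) ,
    (λ p 0<p p<γ → let p<1 = <γ⇒<1 n p p<γ in
      gap⇒≤∧< f (Φ p 0<p p<1 f) (Φ p 0<p p<1 (Maj n)) (Φ-gap-unate n half f unate unbiased p 0<p p<1 p<γ))) ,
  (λ f unbiased p 0<p p<γ′ → let p<1 = <γ′⇒<1 n p p<γ′ in
    gap⇒≤∧< f (Φ p 0<p p<1 f) (Φ p 0<p p<1 (Maj n)) (Φ-gap-general n half f unbiased p 0<p p<1 p<γ′))
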